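{- Let $d\ge 2$ be an integer, and for $h\ge 1$ let $\mathit{Peb}^{d}_{\Pi_h}$ be the pebbling contradiction of degree $d$ over the pyramid graph $\Pi_h$ of height $h$. Then the clause space of refuting $\mathit{Peb}^{d}_{\Pi_h}$ in resolution satisfies $$\mathit{Sp}(\mathit{Peb}^{d}_{\Pi_h}\vdash 0)=\Theta(h).$$
   Context: Resolution. A literal is a propositional variable $x$ or its negation $\overline{x}$. A clause is a finite set (disjunction) of literals over pairwise distinct variables; $0$ denotes the empty clause. A CNF formula is a finite set of clauses. The resolution rule derives $B\vee C$ from $B\vee x$ and $C\vee\overline{x}$. A resolution derivation from a CNF formula $F$ is a sequence $\{\mathbb{C}_0,\dots,\mathbb{C}_\tau\}$ of sets of clauses with $\mathbb{C}_0=\emptyset$ such that each $\mathbb{C}_t$ is obtained from $\mathbb{C}_{t-1}$ by one of: axiom download ($\mathbb{C}_t=\mathbb{C}_{t-1}\cup\{C\}$ with $C\in F$), erasure ($\mathbb{C}_t=\mathbb{C}_{t-1}\setminus\{C\}$ with $C\in\mathbb{C}_{t-1}$), inference ($\mathbb{C}_t=\mathbb{C}_{t-1}\cup\{D\}$ with $D$ derived by the resolution rule from two clauses in $\mathbb{C}_{t-1}$). A refutation of $F$ is a derivation with $\mathbb{C}_\tau=\{0\}$. The clause space of a derivation is $\max_t|\mathbb{C}_t|$, and $\mathit{Sp}(F\vdash 0)$ is the minimum clause space of any refutation of $F$. Pyramid. The pyramid graph $\Pi_h$ of height $h$ is the directed acyclic graph with levels $0,\dots,h$, with $h+1-L$ vertices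 on level $L$ (so one vertex, the sink $z$, on level $h$ and $h+1$ vertices, the sources, on level $0$), where for $L\ge1$ the $i$th vertex on level $L$ has incoming edges exactly from the $i$th and $(i+1)$st vertices on level $L-1$. Pebbling contradiction. Let $G$ be a DAG with source set $S$, a unique sink $z$, and all non-source vertices of indegree $2$, and let $d\ge1$. Associate $d$ distinct variables $x(v)_1,\dots,x(v)_d$ with each vertex $v$. The pebbling contradiction $\mathit{Peb}^d_G$ of degree $d$ is the conjunction of: the clauses $\bigvee_{i=1}^d x(s)_i$ for all $s\in S$; the clauses $\overline{x(z)}_i$ for all $i\in\{1,\dots,d\}$; and the clauses $\overline{x(u)}_i\vee\overline{x(v)}_j\vee\bigvee_{l=1}^d x(w)_l$ for all $i,j\in\{1,\dots,d\}$ and all non-source vertices $w$, where $u,v$ are the two predecessors of $w$. -}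

module Defs where

open import Data.Bool using (Bool; true; false)
import Data.Bool.Properties as Bool
open import Data.Empty using (⊥-elim)
open import Data.Fin using (Fin; toℕ; fromℕ<; combine)
open import Data.Fin.Properties using (toℕ<n; toℕ-fromℕ<)
open import Data.List using (List; []; _∷_; [_]; _++_; map; concatMap; allFin; foldr; length; filter)
open import Data.List.Membership.Propositional using (_∈_)
open import Data.List.Membership.Propositional.Properties
  using (∈-allFin; ∈-map⁺; ∈-concatMap⁺)
open import Data.List.Relation.Unary.All.Properties using (¬Any⇒All¬)
open import Data.List.Relation.Unary.AllPairs using ([]; _∷_)
open import Data.List.Relation.Unary.Any as Any using (index)
open import Data.List.Relation.Unary.Unique.Propositional using (Unique)
open import Data.List.Relation.Unary.Unique.Propositional.Properties using (filter⁺)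
open import Data.Maybe using (Maybe; just; nothing)
import Data.Maybe.Properties as Maybe
open import Data.Nat using (ℕ; zero; suc; _+_; _*_; _∸_; _⊔_; _≤_; _<_; s≤s; s≤s⁻¹; _<?_; _≤?_)
open import Data.Nat.Properties
open import Data.Product using (∃-syntax; _×_; _,_)
open import Data.Sum using (_⊎_; inj₁; inj₂)
open import Data.Vec using (Vec; lookup; replicate; _[_]≔_)
import Data.Vec.Properties as Vec
open import Function.Bundles using (_⇔_; mk⇔)
open import Relation.Binary.Construct.Closure.ReflexiveTransitive using (Star; ε; _◅_)
open import Relation.Binary.Construct.Closure.Transitive using (TransClosure; _∷_) renaming ([_] to [_]⁺)
open import Relation.Binary.Definitions using (DecidableEquality)
open import Relation.Binary.PropositionalEquality
  using (_≡_; _≢_; refl; sym; subst)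
open import Relation.Nullary using (¬_; ¬?; yes; no)
open import Relation.Nullary.Decidable using (recompute)

Literal : ℕ → Set
Literal n = Fin n × Bool

pattern pos x = x , true
pattern neg x = x , false

-- A finite set of literals over pairwise distinct variables is stored as
-- the table giving, for each variable, the sign with which it occurs (if
-- it occurs).  Equality of clauses as sets is therefore _≡_.

Clause : ℕ → Set
Clause n = Vec (Maybe Bool) n

infix 4 _∈ˡ_ _∉ᵛ_
infixl 6 _∨ˡ_

_∈ˡ_ : ∀ {n} → Literal n → Clause n → Set
(x , b) ∈ˡ C = lookup C x ≡ just b

_∉ᵛ_ : ∀ {n} → Fin n → Clause n → Set
x ∉ᵛ C = lookup C x ≡ nothing

𝟘 : ∀ {n} → Clause n
𝟘 = replicate _ nothing

-- Disjunction with one literal; meaningful when C does not contain the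
-- opposite literal (which would be overwritten).

_∨ˡ_ : ∀ {n} → Clause n → Literal n → Clause n
C ∨ˡ (x , b) = C [ x ]≔ just b

⋁ : ∀ {n} → List (Literal n) → Clause n
⋁ = foldr (λ l C → C ∨ˡ l) 𝟘

-- D = B ∨ C is derived from C₁ = B ∨ x and C₂ = C ∨ x̄.  Since D is a
-- clause, the last field rules out B and C that clash on a variable.

record Resolvent {n} (C₁ C₂ D : Clause n) : Set where
  field
    x     : Fin n
    B C   : Clause n
    x∉B   : x ∉ᵛ B
    x∉C   : x ∉ᵛ C
    C₁≡   : C₁ ≡ B ∨ˡ pos x
    C₂≡   : C₂ ≡ C ∨ˡ neg x
    D≡B∨C : ∀ l → l ∈ˡ D ⇔ (l ∈ˡ B ⊎ l ∈ˡ C)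

_≟ᶜ_ : ∀ {n} → DecidableEquality (Clause n)
_≟ᶜ_ = Vec.≡-dec (Maybe.≡-dec Bool._≟_)

module _ {n : ℕ} where
  open import Data.List.Membership.DecPropositional (_≟ᶜ_ {n}) public using (_∈?_)

-- Only membership in a formula matters, so repetitions are harmless.

Formula : ℕ → Set
Formula n = List (Clause n)

-- Sets of clauses held in memory are duplicate-free lists: see
-- derivation-unique below.  Hence length is cardinality.

Config : ℕ → Set
Config n = List (Clause n)

insert : ∀ {n} → Clause n → Config n → Config n
insert C ℂ with C ∈? ℂ
... | yes _ = ℂ
... | no  _ = C ∷ ℂ

remove : ∀ {n} → Clause n → Config n → Config n
remove C = filter (λ D → ¬? (D ≟ᶜ C))

data Step {n} (F : Formula n) (ℂ : Config n) : Config n → Set where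
  download : ∀ {C} → C ∈ F → Step F ℂ (insert C ℂ)
  erase    : ∀ {C} → C ∈ ℂ → Step F ℂ (remove C ℂ)
  infer    : ∀ {C₁ C₂ D} → C₁ ∈ ℂ → C₂ ∈ ℂ → Resolvent C₁ C₂ D →
             Step F ℂ (insert D ℂ)

Refutation : ∀ {n} → Formula n → Set
Refutation F = Star (Step F) [] [ 𝟘 ]

clauseSpace : ∀ {n} {F : Formula n} {ℂ ℂ′} → Star (Step F) ℂ ℂ′ → ℕ
clauseSpace {ℂ = ℂ} ε       = length ℂ
clauseSpace {ℂ = ℂ} (_ ◅ π) = length ℂ ⊔ clauseSpace π

-- "Sp (F ⊢ 0) = s".  The minimum is given by its defining property.

Sp[_⊢𝟘]≡_ : ∀ {n} → Formula n → ℕ → Set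
Sp[ F ⊢𝟘]≡ s =
  (∃[ π ] clauseSpace {F = F} {[]} {[ 𝟘 ]} π ≡ s) ×
  (∀ (π : Refutation F) → s ≤ clauseSpace π)

insert-unique : ∀ {n} (C : Clause n) {ℂ} → Unique ℂ → Unique (insert C ℂ)
insert-unique C {ℂ} u with C ∈? ℂ
... | yes _   = u
... | no  C∉ℂ = ¬Any⇒All¬ ℂ C∉ℂ ∷ u

step-unique : ∀ {n} {F : Formula n} {ℂ ℂ′} → Step F ℂ ℂ′ → Unique ℂ → Unique ℂ′
step-unique (download _)  u = insert-unique _ u
step-unique (erase _)     u = filter⁺ _ u
step-unique (infer _ _ _) u = insert-unique _ u

derivation-unique : ∀ {n} {F : Formula n} {ℂ} → Star (Step F) [] ℂ → Unique ℂ
derivation-unique = go []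
  where
  go : ∀ {n} {F : Formula n} {ℂ ℂ′} → Unique ℂ → Star (Step F) ℂ ℂ′ → Unique ℂ′
  go u ε       = u
  go u (s ◅ π) = go (step-unique s u) π

-- A finite DAG with a unique sink in which every non-source vertex has
-- indegree 2, so that preds determines all the edges.

record PebblingDAG : Set₁ where
  field
    Vertex   : Set
    vertices : List Vertex
    complete : ∀ v → v ∈ vertices

    -- nothing for sources, the two predecessors otherwise
    preds          : Vertex → Maybe (Vertex × Vertex)
    preds-distinct : ∀ {u v w} → preds w ≡ just (u , v) → u ≢ v

  _⟶_ : Vertex → Vertex → Set
  u ⟶ w = ∃[ v ] (preds w ≡ just (u , v) ⊎ preds w ≡ just (v , u))

  field
    acyclic     : ∀ {v} → ¬ TransClosure _⟶_ v v
    sink        : Vertex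
    unique-sink : ∀ v → (∀ w → ¬ (v ⟶ w)) ⇔ v ≡ sink

module _ (d : ℕ) (G : PebblingDAG) where
  open PebblingDAG G

  numVars : ℕ
  numVars = length vertices * d

  -- The variable x(v)ᵢ.  Both combine and v ↦ index (complete v) are
  -- injective, so these variables are distinct.

  var : Vertex → Fin d → Fin numVars
  var v i = combine (index (complete v)) i

  some : Vertex → List (Literal numVars)
  some v = map (λ i → pos (var v i)) (allFin d)

  -- Since G is acyclic, u and v differ from w, so no literal below
  -- overwrites another.

  vertexAxioms : Vertex → Formula numVars
  vertexAxioms w with preds w
  ... | nothing      = [ ⋁ (some w) ]
  ... | just (u , v) =
    concatMap (λ i → map (λ j → ⋁ (neg (var u i) ∷ neg (var v j) ∷ some w)) (allFin d)) (allFin d)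

  sinkAxioms : Formula numVars
  sinkAxioms = map (λ i → ⋁ [ neg (var sink i) ]) (allFin d)

  Peb : Formula numVars
  Peb = concatMap vertexAxioms vertices ++ sinkAxioms

-- Positions are counted from 0, so the h + 1 ∸ L vertices on level L are
-- those with L + position ≤ h.

record PyramidVertex (h : ℕ) : Set where
  constructor vertex
  field
    level position : ℕ
    .bound         : level + position ≤ h

open PyramidVertex

module Pyramid (h : ℕ) where

  onLevel : Fin (suc h) → List (PyramidVertex h)
  onLevel L = map (λ i → vertex (toℕ L) (toℕ i) (bnd i)) (allFin (suc h ∸ toℕ L))
    where
    bnd : (i : Fin (suc h ∸ toℕ L)) → toℕ L + toℕ i ≤ h
    bnd i = s≤s⁻¹ (subst (toℕ L + toℕ i <_) (m+[n∸m]≡n (<⇒≤ (toℕ<n L)))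
                         (+-monoʳ-< (toℕ L) (toℕ<n i)))

  vertices : List (PyramidVertex h)
  vertices = concatMap onLevel (allFin (suc h))

  vertex-cong : ∀ {L L′ i i′} .{b b′} → L ≡ L′ → i ≡ i′ →
                _≡_ {A = PyramidVertex h} (vertex L i b) (vertex L′ i′ b′)
  vertex-cong refl refl = refl

  complete : ∀ v → v ∈ vertices
  complete (vertex L i b) =
    ∈-concatMap⁺ onLevel (Any.map (λ { refl → on }) (∈-allFin L′))
    where
    b′ : L + i ≤ h
    b′ = recompute (_ ≤? _) b
    L< : L < suc h
    L< = s≤s (≤-trans (m≤m+n L i) b′)
    L′ : Fin (suc h)
    L′ = fromℕ< L<
    i< : i < suc h ∸ toℕ L′
    i< = subst (λ k → i < suc h ∸ k) (sym (toℕ-fromℕ< L<))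
           (m+n≤o⇒m≤o∸n (suc i) (s≤s (subst (_≤ h) (+-comm L i) b′)))
    on : vertex L i b ∈ onLevel L′
    on = subst (_∈ onLevel L′) (vertex-cong (toℕ-fromℕ< L<) (toℕ-fromℕ< i<))
           (∈-map⁺ _ (∈-allFin (fromℕ< i<)))

  preds : PyramidVertex h → Maybe (PyramidVertex h × PyramidVertex h)
  preds (vertex zero    i b) = nothing
  preds (vertex (suc L) i b) =
    just ( vertex L i       (<⇒≤ b)
         , vertex L (suc i) (subst (_≤ h) (sym (+-suc L i)) b) )

  preds-distinct : ∀ {u v w} → preds w ≡ just (u , v) → u ≢ v
  preds-distinct {w = vertex (suc L) i b} refl ()

  sink : PyramidVertex h
  sink = vertex h 0 (≤-reflexive (+-identityʳ h))

  _⟶_ : PyramidVertex h → PyramidVertex h → Set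
  u ⟶ w = ∃[ v ] (preds w ≡ just (u , v) ⊎ preds w ≡ just (v , u))

  ⟶-level : ∀ {u w} → u ⟶ w → level u < level w
  ⟶-level {w = vertex (suc L) i b} (_ , inj₁ refl) = ≤-refl
  ⟶-level {w = vertex (suc L) i b} (_ , inj₂ refl) = ≤-refl

  ⟶⁺-level : ∀ {u w} → TransClosure _⟶_ u w → level u < level w
  ⟶⁺-level [ e ]⁺  = ⟶-level e
  ⟶⁺-level (e ∷ p) = <-trans (⟶-level e) (⟶⁺-level p)

  no-out⇒sink : ∀ v → (∀ w → ¬ (v ⟶ w)) → v ≡ sink
  no-out⇒sink (vertex L (suc i) b) out =
    ⊥-elim (out (vertex (suc L) i (subst (_≤ h) (+-suc L i) b)) (_ , inj₂ refl))
  no-out⇒sink (vertex L zero b) out with L <? h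
  ... | yes L<h = ⊥-elim (out (vertex (suc L) zero (subst (_≤ h) (sym (+-identityʳ (suc L))) L<h))
                              (_ , inj₁ refl))
  ... | no  L≮h = vertex-cong
    (≤-antisym (subst (_≤ h) (+-identityʳ L) (recompute (_ ≤? _) b)) (≮⇒≥ L≮h)) refl

  sink⇒no-out : ∀ v → v ≡ sink → ∀ w → ¬ (v ⟶ w)
  sink⇒no-out _ refl (vertex L i b) e =
    <⇒≱ (⟶-level e) (≤-trans (m≤m+n L i) (recompute (_ ≤? _) b))

pyramid : ℕ → PebblingDAG
pyramid h = record
  { Vertex         = PyramidVertex h
  ; vertices       = vertices
  ; complete       = complete
  ; preds          = preds
  ; preds-distinct = λ {_} {_} {w} → preds-distinct {w = w}
  ; acyclic        = λ p → <-irrefl refl (⟶⁺-level p)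
  ; sink           = sink
  ; unique-sink    = λ v → mk⇔ (no-out⇒sink v) (sink⇒no-out v)
  }
  where open Pyramid h

-- The lower constant is written as 1 / a; by the Archimedean property
-- this is the same as allowing arbitrary positive real constants.

_∈Θ_ : (ℕ → ℕ) → (ℕ → ℕ) → Set
f ∈Θ g = ∃[ a ] ∃[ b ] ∃[ n₀ ] (0 < a × 0 < b ×
  (∀ n → n₀ ≤ n → g n ≤ a * f n × f n ≤ b * g n))

{-# OPTIONS --safe #-}

-- Upper bound: the clause "v is true" is derived by recursion on the level of
-- v, from the clauses of its two predecessors; each level costs one further
-- clause.  The minimum over all refutations exists because refutability in
-- space s is reachability in a finite graph.
--
-- Lower bound: for a set T of vertices closed under propagation (if both
-- predecessors of w are in T, so is w) that avoids the sink, and a choice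
-- ι v < d of one variable for each vertex v, let α be the assignment that makes
-- x(v)ₖ true iff v ∈ T and k = ι v.  It satisfies every axiom but those of the
-- sources outside T.  Say that U hides a clause set if, for some fixed ι, α
-- satisfies it whenever T ⊇ U.  Along a refutation this is preserved if a source
-- is added to U when its axiom is downloaded, and at the end U meets all paths
-- from the sources to the sink.  Before each download U is shrunk to at most 4s
-- vertices, s being the current space:
-- changing ι at one vertex per clause (possible as d ≥ 2) makes all clauses
-- true except some that involve at most 2s vertices negatively, and what U
-- does for those is then compressed as in Klawe's lower bound for the
-- black-white pebbling of pyramids.  Klawe's measure never exceeds 16s + 4 in the
-- process, but a set that hides the sink has measure at least h.

module Submission where

open import Defs
open import Data.Bool using (Bool; true; false; _∧_)
import Data.Bool.Properties as Bool
open import Data.Fin using (Fin; zero; suc; fromℕ<; remQuot)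
import Data.Fin.Properties as Fin
open import Data.List using (List; []; _∷_; [_]; _++_; map; length; filter; allFin; concatMap; cartesianProductWith)
import Data.List as List
open import Data.List.Membership.Propositional using (_∈_; _∉_; find; lose)
open import Data.List.Membership.Propositional.Properties
import Data.List.Properties as List
open import Data.List.Relation.Binary.Subset.Propositional using (_⊆_)
open import Data.List.Relation.Unary.All as All using ([]; _∷_)
open import Data.List.Relation.Unary.AllPairs using ([]; _∷_)
open import Data.List.Relation.Unary.Any as Any using (here; there; any?; index)
open import Data.List.Relation.Unary.Any.Properties using (lookup-index)
open import Data.List.Relation.Unary.Unique.Propositional using (Unique)
import Data.List.Relation.Unary.Unique.Propositional.Properties as Unique
open import Data.Maybe using (Maybe; just; nothing)
import Data.Maybe.Properties as Maybe
open import Data.Nat using (ℕ; zero; suc; _+_; _*_; _⊓_; _≤_; _<_; z≤n; s≤s; _≤?_; _<?_)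
open import Data.Nat.Induction using (<-wellFounded)
open import Data.Nat.Properties
open import Data.Nat.Tactic.RingSolver using (solve-∀)
open import Data.Product using (∃-syntax; _×_; _,_; proj₁; proj₂)
open import Data.Sum as Sum using (_⊎_; inj₁; inj₂; [_,_]′)
open import Data.Vec using (Vec; []; _∷_; lookup)
import Data.Vec.Properties as Vec
open import Function using (_∘_; case_of_; id)
open import Function.Bundles using (_⇔_; mk⇔; Equivalence)
open import Induction.WellFounded using (Acc; acc)
open import Relation.Binary.Construct.Closure.ReflexiveTransitive as Star using (Star; ε; _◅_; _◅◅_)
open import Relation.Binary.Construct.Closure.Transitive using () renaming ([_] to [_]⁺)
open import Relation.Binary.Definitions using (DecidableEquality; Decidable)
open import Relation.Binary.PropositionalEquality hiding ([_])
open import Relation.Nullary using (¬_; ¬?; Dec; yes; no; contradiction; does)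
open import Relation.Nullary.Decidable using (map′; _×-dec_; _⊎-dec_; _→-dec_; dec-true; dec-false)
open import Relation.Unary using () renaming (Decidable to Decidable₁)

-- Existence of the minimum space

-- Warshall's recursion decides reachability: Via L x y says that y can be
-- reached from x through intermediate nodes in L.

module _ {A : Set} (E : A → A → Set) where

  Via : List A → A → A → Set
  Via []      x y = x ≡ y ⊎ E x y
  Via (v ∷ L) x y = Via L x y ⊎ (Via L x v × Via L v y)

  via? : DecidableEquality A → Decidable E → ∀ L → Decidable (Via L)
  via? _≟_ E? []      x y = (x ≟ y) ⊎-dec E? x y
  via? _≟_ E? (v ∷ L) x y = via? _≟_ E? L x y ⊎-dec (via? _≟_ E? L x v ×-dec via? _≟_ E? L v y)

  via⇒star : ∀ L {x y} → Via L x y → Star E x y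
  via⇒star []      (inj₁ refl)    = ε
  via⇒star []      (inj₂ e)       = e ◅ ε
  via⇒star (v ∷ L) (inj₁ p)       = via⇒star L p
  via⇒star (v ∷ L) (inj₂ (p , q)) = via⇒star L p ◅◅ via⇒star L q

  via-base : ∀ L {x y} → x ≡ y ⊎ E x y → Via L x y
  via-base []      p = p
  via-base (v ∷ L) p = inj₁ (via-base L p)

  via-trans : ∀ L {v} → v ∈ L → ∀ {x y} → Via L x v → Via L v y → Via L x y
  via-trans (u ∷ L) (here refl) p q = inj₂ (into p , outOf q)
    where
    into : ∀ {x} → Via (u ∷ L) x u → Via L x u
    into (inj₁ p)       = p
    into (inj₂ (p , _)) = p
    outOf : ∀ {y} → Via (u ∷ L) u y → Via L u y
    outOf (inj₁ q)       = q
    outOf (inj₂ (_ , q)) = q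
  via-trans (u ∷ L) (there v∈L) (inj₁ p)       (inj₁ q)       = inj₁ (via-trans L v∈L p q)
  via-trans (u ∷ L) (there v∈L) (inj₁ p)       (inj₂ (q , r)) = inj₂ (via-trans L v∈L p q , r)
  via-trans (u ∷ L) (there v∈L) (inj₂ (p , q)) (inj₁ r)       = inj₂ (p , via-trans L v∈L q r)
  -- Both halves pass through the pivot `u`; the loop from `u` through `v` back to `u` is cut out.
  via-trans (u ∷ L) (there v∈L) (inj₂ (p , _)) (inj₂ (_ , r)) = inj₂ (p , r)

  -- A path is cut only at targets of its edges, so these alone have to lie in `L`.
  star⇒via : ∀ L → (∀ {x y} → E x y → y ∈ L) → ∀ {x y} → Star E x y → Via L x y
  star⇒via L E∈L ε       = via-base L (inj₁ refl)
  star⇒via L E∈L (e ◅ p) = via-trans L (E∈L e) (via-base L (inj₂ e)) (star⇒via L E∈L p)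

-- Finite search spaces and decidability of derivation steps

allVecs : ∀ {A : Set} → List A → ∀ n → List (Vec A n)
allVecs as zero    = [ [] ]
allVecs as (suc n) = cartesianProductWith _∷_ as (allVecs as n)

∈-allVecs : ∀ {A : Set} {as : List A} → (∀ a → a ∈ as) → ∀ {n} (v : Vec A n) → v ∈ allVecs as n
∈-allVecs all []      = here refl
∈-allVecs all (a ∷ v) = ∈-cartesianProductWith⁺ _∷_ (all a) (∈-allVecs all v)

allLists : ∀ {A : Set} → List A → ℕ → List (List A)
allLists as zero    = [ [] ]
allLists as (suc k) = [] ∷ cartesianProductWith _∷_ as (allLists as k)

∈-allLists : ∀ {A : Set} {as : List A} → (∀ a → a ∈ as) →
             ∀ k (xs : List A) → length xs ≤ k → xs ∈ allLists as k
∈-allLists all zero    []       _       = here refl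
∈-allLists all (suc k) []       _       = here refl
∈-allLists all (suc k) (x ∷ xs) (s≤s p) =
  there (∈-cartesianProductWith⁺ _∷_ (all x) (∈-allLists all k xs p))

signs : List (Maybe Bool)
signs = nothing ∷ just true ∷ just false ∷ []

∈-signs : ∀ m → m ∈ signs
∈-signs nothing      = here refl
∈-signs (just true)  = there (here refl)
∈-signs (just false) = there (there (here refl))

allClauses : ∀ n → List (Clause n)
allClauses = allVecs signs

∈-allClauses : ∀ {n} (C : Clause n) → C ∈ allClauses n
∈-allClauses = ∈-allVecs ∈-signs

∃∈? : ∀ {A : Set} {P : A → Set} → (∀ a → Dec (P a)) → ∀ xs → Dec (∃[ x ] (x ∈ xs × P x))
∃∈? P? xs = map′ find (λ (_ , x∈xs , p) → lose x∈xs p) (any? P? xs)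

∃clause? : ∀ {n} {P : Clause n → Set} → (∀ C → Dec (P C)) → Dec (∃[ C ] P C)
∃clause? P? = map′ (λ (C , _ , p) → C , p) (λ (C , p) → C , ∈-allClauses C , p)
                   (∃∈? P? (allClauses _))

∀bool? : {P : Bool → Set} → (∀ b → Dec (P b)) → Dec (∀ b → P b)
∀bool? P? = map′ (λ { (p , q) true → p ; (p , q) false → q }) (λ f → f true , f false)
                 (P? true ×-dec P? false)

_⇔-dec_ : {P Q : Set} → Dec P → Dec Q → Dec (P ⇔ Q)
P? ⇔-dec Q? = map′ (λ (f , g) → mk⇔ f g) (λ e → Equivalence.to e , Equivalence.from e)
                   ((P? →-dec Q?) ×-dec (Q? →-dec P?))

_∈ˡ?_ : ∀ {n} (l : Literal n) (C : Clause n) → Dec (l ∈ˡ C)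
(x , b) ∈ˡ? C = Maybe.≡-dec Bool._≟_ (lookup C x) (just b)

resolvent? : ∀ {n} (C₁ C₂ D : Clause n) → Dec (Resolvent C₁ C₂ D)
resolvent? C₁ C₂ D = map′
  (λ { (x , B , C , x∉B , x∉C , e₁ , e₂ , f) → record
       { x = x ; B = B ; C = C ; x∉B = x∉B ; x∉C = x∉C ; C₁≡ = e₁ ; C₂≡ = e₂
       ; D≡B∨C = λ (y , b) → f y b } })
  (λ r → let open Resolvent r in
       x , B , C , x∉B , x∉C , C₁≡ , C₂≡ , λ y b → D≡B∨C (y , b))
  (Fin.any? λ x → ∃clause? λ B → ∃clause? λ C →
     Maybe.≡-dec Bool._≟_ (lookup B x) nothing ×-dec
     (Maybe.≡-dec Bool._≟_ (lookup C x) nothing ×-dec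
     ((C₁ ≟ᶜ (B ∨ˡ pos x)) ×-dec ((C₂ ≟ᶜ (C ∨ˡ neg x)) ×-dec
     Fin.all? λ y → ∀bool? λ b →
       ((y , b) ∈ˡ? D) ⇔-dec (((y , b) ∈ˡ? B) ⊎-dec ((y , b) ∈ˡ? C))))))

module _ {n} (F : Formula n) where

  _≟ᴹ_ : DecidableEquality (Config n)
  _≟ᴹ_ = List.≡-dec _≟ᶜ_

  step? : Decidable (Step F)
  step? ℂ ℂ′ = map′ to from
    (∃∈? (λ C → insert C ℂ ≟ᴹ ℂ′) F ⊎-dec
    (∃∈? (λ C → remove C ℂ ≟ᴹ ℂ′) ℂ ⊎-dec
     ∃∈? (λ C₁ → ∃∈? (λ C₂ → ∃clause? λ D → resolvent? C₁ C₂ D ×-dec (insert D ℂ ≟ᴹ ℂ′)) ℂ) ℂ))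
    where
    to : _ → Step F ℂ ℂ′
    to (inj₁ (C , C∈F , refl))                                        = download C∈F
    to (inj₂ (inj₁ (C , C∈ℂ , refl)))                                 = erase C∈ℂ
    to (inj₂ (inj₂ (C₁ , C₁∈ℂ , C₂ , C₂∈ℂ , D , r , refl))) = infer C₁∈ℂ C₂∈ℂ r
    from : Step F ℂ ℂ′ → _
    from (download C∈F)       = inj₁ (_ , C∈F , refl)
    from (erase C∈ℂ)          = inj₂ (inj₁ (_ , C∈ℂ , refl))
    from (infer C₁∈ℂ C₂∈ℂ r) = inj₂ (inj₂ (_ , C₁∈ℂ , _ , C₂∈ℂ , _ , r , refl))

  -- Bounding the target is enough, since the paths of interest start from the empty memory. It puts
  -- the target of every edge into the finite list `allLists (allClauses n) s`.
  BoundedStep : ℕ → Config n → Config n → Set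
  BoundedStep s ℂ ℂ′ = Step F ℂ ℂ′ × length ℂ′ ≤ s

  bounded⇒derivation : ∀ {s ℂ ℂ′} → length ℂ ≤ s → Star (BoundedStep s) ℂ ℂ′ →
                       ∃[ π ] clauseSpace {F = F} {ℂ} {ℂ′} π ≤ s
  bounded⇒derivation ℂ≤s ε = ε , ℂ≤s
  bounded⇒derivation ℂ≤s ((e , ℂ′≤s) ◅ π) =
    let π′ , π′≤s = bounded⇒derivation ℂ′≤s π in e ◅ π′ , ⊔-lub ℂ≤s π′≤s

  start≤clauseSpace : ∀ {ℂ ℂ′} (π : Star (Step F) ℂ ℂ′) → length ℂ ≤ clauseSpace π
  start≤clauseSpace ε       = ≤-refl
  start≤clauseSpace (_ ◅ π) = m≤m⊔n _ (clauseSpace π)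

  derivation⇒bounded : ∀ {s ℂ ℂ′} (π : Star (Step F) ℂ ℂ′) → clauseSpace π ≤ s →
                       Star (BoundedStep s) ℂ ℂ′
  derivation⇒bounded ε _ = ε
  derivation⇒bounded {ℂ = ℂ} (e ◅ π) le =
    (e , ≤-trans (start≤clauseSpace π) π≤s) ◅ derivation⇒bounded π π≤s
    where π≤s = m⊔n≤o⇒n≤o (length ℂ) (clauseSpace π) le

  RefutableIn : ℕ → Set
  RefutableIn s = ∃[ π ] clauseSpace {F = F} {[]} {[ 𝟘 ]} π ≤ s

  refutableIn? : ∀ s → Dec (RefutableIn s)
  refutableIn? s = map′
    (λ p → bounded⇒derivation z≤n (via⇒star (BoundedStep s) L p))
    (λ (π , π≤s) → star⇒via (BoundedStep s) L (λ (_ , le) → ∈-allLists ∈-allClauses s _ le)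
                      (derivation⇒bounded π π≤s))
    (via? (BoundedStep s) _≟ᴹ_ (λ ℂ ℂ′ → step? ℂ ℂ′ ×-dec (length ℂ′ ≤? s)) L [] [ 𝟘 ])
    where L = allLists (allClauses n) s

least : {P : ℕ → Set} → (∀ n → Dec (P n)) → ∀ n → P n → ∃[ m ] (P m × m ≤ n × (∀ k → P k → m ≤ k))
least {P} P? n pn = search n 0 refl (λ _ _ → z≤n)
  where
  search : ∀ fuel m → m + fuel ≡ n → (∀ k → P k → m ≤ k) → ∃[ m ] (P m × m ≤ n × (∀ k → P k → m ≤ k))
  -- The fuel is the distance from `m` to `n`; once it is spent, `pn` serves as the witness.
  search zero m eq lb = n , pn , ≤-refl , λ k pk → subst (_≤ k) (trans (sym (+-identityʳ m)) eq) (lb k pk)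
  search (suc f) m eq lb with P? m
  ... | yes pm = m , pm , subst (m ≤_) eq (m≤m+n m (suc f)) , lb
  ... | no ¬pm = search f (suc m) (trans (sym (+-suc m f)) eq)
                   λ k pk → ≤∧≢⇒< (lb k pk) λ { refl → ¬pm pk }

space-exists : ∀ {n} (F : Formula n) k → RefutableIn F k → ∃[ s ] (Sp[ F ⊢𝟘]≡ s × s ≤ k)
space-exists F k r with s , (π , π≤s) , s≤k , lb ← least (refutableIn? F) k r =
  s , ((π , ≤-antisym π≤s (lb _ (π , ≤-refl))) , λ π′ → lb _ (π′ , ≤-refl)) , s≤k

-- Derivations up to the contents of the memory

∈⋁⁻ : ∀ {n} (ls : List (Literal n)) {l} → l ∈ˡ ⋁ ls → l ∈ ls
∈⋁⁻ [] {y , b} e = case trans (sym (Vec.lookup-replicate y nothing)) e of λ ()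
∈⋁⁻ ((x , a) ∷ ls) {y , b} e with y Fin.≟ x
... | yes refl = here (cong (y ,_) (Maybe.just-injective (trans (sym e) (Vec.lookup∘update y (⋁ ls) (just a)))))
... | no  y≢x  = there (∈⋁⁻ ls (trans (sym (Vec.lookup∘update′ y≢x (⋁ ls) (just a))) e))

Consistent : ∀ {n} → List (Literal n) → Set
Consistent ls = ∀ {x a b} → (x , a) ∈ ls → (x , b) ∈ ls → a ≡ b

consistent-∷ : ∀ {n} {x : Fin n} {a ls} → (∀ b → (x , b) ∉ ls) → Consistent ls → Consistent ((x , a) ∷ ls)
consistent-∷ x∉ con (here refl) (here refl) = refl
consistent-∷ x∉ con (here refl) (there q)   = contradiction q (x∉ _)
consistent-∷ x∉ con (there p)   (here refl) = contradiction p (x∉ _)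
consistent-∷ x∉ con (there p)   (there q)   = con p q

-- A literal near the head of the list overwrites later ones on the same variable; consistency makes
-- it overwrite them by themselves.
∈⋁⁺ : ∀ {n} {ls : List (Literal n)} → Consistent ls → ∀ {l} → l ∈ ls → l ∈ˡ ⋁ ls
∈⋁⁺ {ls = (x , a) ∷ ls} con {y , b} l∈ with y Fin.≟ x
... | yes refl = trans (Vec.lookup∘update y (⋁ ls) (just a)) (cong just (con (here refl) l∈))
... | no  y≢x  = trans (Vec.lookup∘update′ y≢x (⋁ ls) (just a)) (rest l∈)
  where
  rest : (y , b) ∈ (x , a) ∷ ls → (y , b) ∈ˡ ⋁ ls
  rest (here e)   = contradiction (cong proj₁ e) y≢x
  rest (there l∈) = ∈⋁⁺ (λ p q → con (there p) (there q)) l∈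

∉ᵛ⋁ : ∀ {n} (ls : List (Literal n)) {x} → (∀ b → (x , b) ∉ ls) → x ∉ᵛ ⋁ ls
∉ᵛ⋁ ls {x} x∉ with lookup (⋁ ls) x in eq
... | nothing = refl
... | just b  = contradiction (∈⋁⁻ ls eq) (x∉ b)

-- `ls` has to be the union of `ls₁` and `ls₂` only up to order and repetition. Hence the
-- formulation by membership: the parents may share literals, as they share `t` in `resolve-head`.
resolve : ∀ {n} {x : Fin n} {ls₁ ls₂ ls} → ls₁ ⊆ ls → ls₂ ⊆ ls →
          (∀ {l} → l ∈ ls → l ∈ ls₁ ⊎ l ∈ ls₂) → Consistent ls → (∀ b → (x , b) ∉ ls) →
          Resolvent (⋁ (pos x ∷ ls₁)) (⋁ (neg x ∷ ls₂)) (⋁ ls)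
resolve {x = x} {ls₁} {ls₂} {ls} ⊆₁ ⊆₂ split con x∉ = record
  { x = x ; B = ⋁ ls₁ ; C = ⋁ ls₂
  ; x∉B = ∉ᵛ⋁ ls₁ (λ b → x∉ b ∘ ⊆₁) ; x∉C = ∉ᵛ⋁ ls₂ (λ b → x∉ b ∘ ⊆₂)
  ; C₁≡ = refl ; C₂≡ = refl
  ; D≡B∨C = λ l → mk⇔
      (λ l∈ → Sum.map (∈⋁⁺ (λ p q → con (⊆₁ p) (⊆₁ q))) (∈⋁⁺ (λ p q → con (⊆₂ p) (⊆₂ q)))
                      (split (∈⋁⁻ ls l∈)))
      [ ∈⋁⁺ con ∘ ⊆₁ ∘ ∈⋁⁻ ls₁ , ∈⋁⁺ con ∘ ⊆₂ ∘ ∈⋁⁻ ls₂ ]′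
  }

∈-insert⁻ : ∀ {n} (C : Clause n) ℂ {D} → D ∈ insert C ℂ → D ≡ C ⊎ D ∈ ℂ
∈-insert⁻ C ℂ D∈ with C ∈? ℂ
∈-insert⁻ C ℂ D∈         | yes _ = inj₂ D∈
∈-insert⁻ C ℂ (here e)   | no  _ = inj₁ e
∈-insert⁻ C ℂ (there D∈) | no  _ = inj₂ D∈

∈-insert⁺ : ∀ {n} (C : Clause n) ℂ {D} → D ≡ C ⊎ D ∈ ℂ → D ∈ insert C ℂ
∈-insert⁺ C ℂ D∈ with C ∈? ℂ
∈-insert⁺ C ℂ (inj₁ refl) | yes C∈ = C∈
∈-insert⁺ C ℂ (inj₂ D∈)   | yes _  = D∈
∈-insert⁺ C ℂ (inj₁ e)    | no  _  = here e
∈-insert⁺ C ℂ (inj₂ D∈)   | no  _  = there D∈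

length-insert : ∀ {n} (C : Clause n) ℂ → length (insert C ℂ) ≤ suc (length ℂ)
length-insert C ℂ with C ∈? ℂ
... | yes _ = n≤1+n _
... | no  _ = ≤-refl

unique-⊆⇒length≤ : ∀ {A : Set} → DecidableEquality A → ∀ {xs ys : List A} →
                   Unique xs → xs ⊆ ys → length xs ≤ length ys
unique-⊆⇒length≤ _≟_ [] _ = z≤n
unique-⊆⇒length≤ _≟_ {x ∷ xs} {ys} (x∉xs ∷ u) sub =
  ≤-trans (s≤s (unique-⊆⇒length≤ _≟_ u sub′))
          (List.filter-notAll (λ y → ¬? (y ≟ x)) ys (Any.map (λ x≡y ¬p → ¬p (sym x≡y)) (sub (here refl))))
  where
  sub′ : xs ⊆ filter (λ y → ¬? (y ≟ x)) ys
  sub′ y∈ = ∈-filter⁺ _ (sub (there y∈)) λ { refl → All.lookup x∉xs y∈ refl }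

module _ {n} (F : Formula n) (k : ℕ) where

  -- S lists the clauses in memory, possibly with repetitions, so that
  -- length S is only an upper bound for the space.

  Reachable : List (Clause n) → Set
  Reachable S = ∃[ ℂ ] (Star (BoundedStep F k) [] ℂ × ℂ ⊆ S × S ⊆ ℂ)

  bounded-length : ∀ {ℂ S} → Star (BoundedStep F k) [] ℂ → ℂ ⊆ S → length ℂ ≤ length S
  bounded-length π = unique-⊆⇒length≤ _≟ᶜ_ (derivation-unique (Star.map proj₁ π))

  extend : ∀ {S D} → (∀ {ℂ} → S ⊆ ℂ → Step F ℂ (insert D ℂ)) →
           length S < k → Reachable S → Reachable (D ∷ S)
  extend {S} {D} step S<k (ℂ , π , ℂ⊆S , S⊆ℂ) =
    insert D ℂ
    , π ◅◅ ((step S⊆ℂ , ≤-trans (length-insert D ℂ) (≤-trans (s≤s (bounded-length π ℂ⊆S)) S<k)) ◅ ε)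
    , [ here , there ∘ ℂ⊆S ]′ ∘ ∈-insert⁻ D ℂ
    , λ { (here e) → ∈-insert⁺ D ℂ (inj₁ e) ; (there C∈) → ∈-insert⁺ D ℂ (inj₂ (S⊆ℂ C∈)) }

  reach-axiom : ∀ {S C} → C ∈ F → length S < k → Reachable S → Reachable (C ∷ S)
  reach-axiom C∈F = extend (λ _ → download C∈F)

  reach-resolvent : ∀ {S C₁ C₂ D} → C₁ ∈ S → C₂ ∈ S → Resolvent C₁ C₂ D →
                    length S < k → Reachable S → Reachable (D ∷ S)
  reach-resolvent C₁∈ C₂∈ r = extend (λ S⊆ℂ → infer (S⊆ℂ C₁∈) (S⊆ℂ C₂∈) r)

  end≤k : ∀ {ℂ} → Star (BoundedStep F k) [] ℂ → length ℂ ≤ k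
  end≤k π = go z≤n π
    where
    go : ∀ {ℂ ℂ′} → length ℂ ≤ k → Star (BoundedStep F k) ℂ ℂ′ → length ℂ′ ≤ k
    go le ε             = le
    go _  ((_ , le) ◅ π) = go le π

  -- `xs` is the work list: every clause in memory is wanted or still to be examined. An examined
  -- clause is erased if it is in memory and outside `S`.
  prune : ∀ {S} xs {ℂ} → Star (BoundedStep F k) [] ℂ → (∀ {C} → C ∈ ℂ → C ∈ S ⊎ C ∈ xs) → S ⊆ ℂ →
          Reachable S
  prune [] π ℂ⊆ S⊆ℂ = _ , π , [ id , (λ ()) ]′ ∘ ℂ⊆ , S⊆ℂ
  prune {S} (x ∷ xs) {ℂ} π ℂ⊆ S⊆ℂ with x ∈? S
  ... | yes x∈S = prune xs π (λ C∈ → drop (ℂ⊆ C∈)) S⊆ℂ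
    where
    drop : ∀ {C} → C ∈ S ⊎ C ∈ x ∷ xs → C ∈ S ⊎ C ∈ xs
    drop (inj₁ C∈)          = inj₁ C∈
    drop (inj₂ (here refl)) = inj₁ x∈S
    drop (inj₂ (there C∈))  = inj₂ C∈
  ... | no x∉S with x ∈? ℂ
  ...   | no x∉ℂ = prune xs π (λ C∈ → drop C∈ (ℂ⊆ C∈)) S⊆ℂ
    where
    drop : ∀ {C} → C ∈ ℂ → C ∈ S ⊎ C ∈ x ∷ xs → C ∈ S ⊎ C ∈ xs
    drop _   (inj₁ C∈)          = inj₁ C∈
    drop C∈ℂ (inj₂ (here refl)) = contradiction C∈ℂ x∉ℂ
    drop _   (inj₂ (there C∈))  = inj₂ C∈
  ...   | yes x∈ℂ = prune xs
            (π ◅◅ ((erase x∈ℂ , ≤-trans (List.length-filter _ ℂ) (end≤k π)) ◅ ε))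
            (λ C∈ → let C∈ℂ , C≢x = ∈-filter⁻ (λ D → ¬? (D ≟ᶜ x)) {xs = ℂ} C∈ in drop C≢x (ℂ⊆ C∈ℂ))
            (λ C∈ → ∈-filter⁺ _ (S⊆ℂ C∈) λ { refl → x∉S C∈ })
    where
    drop : ∀ {C} → C ≢ x → C ∈ S ⊎ C ∈ x ∷ xs → C ∈ S ⊎ C ∈ xs
    drop _   (inj₁ C∈)         = inj₁ C∈
    drop C≢x (inj₂ (here e))   = contradiction e C≢x
    drop _   (inj₂ (there C∈)) = inj₂ C∈

  weaken : ∀ {S S′} → S′ ⊆ S → Reachable S → Reachable S′
  weaken sub (ℂ , π , ℂ⊆S , S⊆ℂ) = prune ℂ π inj₂ (S⊆ℂ ∘ sub)

  reachable𝟘⇒refutable : Reachable [ 𝟘 ] → RefutableIn F k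
  reachable𝟘⇒refutable (ℂ , π , ℂ⊆ , ⊆ℂ) =
    bounded⇒derivation F z≤n (subst (Star (BoundedStep F k) []) (singleton ℂ unique ℂ⊆ ⊆ℂ) π)
    where
    unique = derivation-unique (Star.map proj₁ π)
    singleton : ∀ ℂ → Unique ℂ → ℂ ⊆ [ 𝟘 ] → [ 𝟘 ] ⊆ ℂ → ℂ ≡ [ 𝟘 ]
    singleton []          _                  _  ⊇ = case ⊇ (here refl) of λ ()
    singleton (C ∷ [])    _                  ⊆  _ with here refl ← ⊆ (here refl) = refl
    singleton (C ∷ D ∷ _) ((C≢D ∷ _) ∷ _) ⊆  _
      with here refl ← ⊆ (here refl) | here refl ← ⊆ (there (here refl)) = contradiction refl C≢D

  -- Eliminating a block of variables

  positives : List (Fin n) → List (Literal n)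
  positives = map (_, true)

  -- The side clauses are made on demand rather than stored. The allowance of one clause per element
  -- of `xs` is for the intermediate resolvents, which `eliminate` keeps in memory until its end.
  Producible : List (Fin n) → List (Literal n) → List (Clause n) → Set
  Producible xs t S = ∀ {x S′} → x ∈ xs → S ⊆ S′ → length S′ ≤ length S + length xs →
                      Reachable S′ → Reachable (⋁ (neg x ∷ t) ∷ S′)

  module _ {t : List (Literal n)} (con : Consistent t) where

    Fresh : List (Fin n) → Set
    Fresh xs = ∀ {x} → x ∈ xs → ∀ b → (x , b) ∉ t

    clash-free : ∀ xs → Fresh xs → Consistent (positives xs ++ t)
    clash-free xs fresh {x} {a} {b} p q with ∈-++⁻ (positives xs) p | ∈-++⁻ (positives xs) q
    ... | inj₂ p | inj₂ q = con p q
    ... | inj₁ p | inj₂ q with _ , x∈ , refl ← ∈-map⁻ _ p = contradiction q (fresh x∈ b)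
    ... | inj₂ p | inj₁ q with _ , x∈ , refl ← ∈-map⁻ _ q = contradiction p (fresh x∈ a)
    ... | inj₁ p | inj₁ q with _ , _ , refl ← ∈-map⁻ _ p | _ , _ , refl ← ∈-map⁻ _ q = refl

    -- `ls` is `positives xs` in the first resolution of a block, before `t` has entered the clause,
    -- and `positives xs ++ t` in the later ones.
    resolve-head : ∀ {x xs S ls} → Unique (x ∷ xs) → Fresh (x ∷ xs) →
                   ls ⊆ positives xs ++ t → positives xs ⊆ ls →
                   Producible (x ∷ xs) t S → length S + length (x ∷ xs) < k →
                   ⋁ (pos x ∷ ls) ∈ S → Reachable S → Reachable (⋁ (positives xs ++ t) ∷ S)
    resolve-head {x} {xs} {S} {ls} (x∉xs ∷ _) fresh ls⊆ ⊆ls prod small C∈S reach =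
      weaken (λ { (here e) → here e ; (there C∈) → there (there C∈) })
        (reach-resolvent (there C∈S) (here refl) res small′ (prod (here refl) id (m≤m+n _ _) reach))
      where
      small′ : suc (length S) < k
      small′ = ≤-trans (s≤s (≤-trans (≤-reflexive (sym (+-comm (length S) 1))) (+-monoʳ-≤ (length S) (s≤s z≤n)))) small
      split : ∀ {l} → l ∈ positives xs ++ t → l ∈ ls ⊎ l ∈ t
      split l∈ = Sum.map₁ ⊆ls (∈-++⁻ (positives xs) l∈)
      x∉ : ∀ b → (x , b) ∉ positives xs ++ t
      x∉ b p with ∈-++⁻ (positives xs) p
      ... | inj₂ q = fresh (here refl) b q
      ... | inj₁ q with _ , x∈ , refl ← ∈-map⁻ _ q = All.lookup x∉xs x∈ refl
      res : Resolvent (⋁ (pos x ∷ ls)) (⋁ (neg x ∷ t)) (⋁ (positives xs ++ t))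
      res = resolve ls⊆ (∈-++⁺ʳ (positives xs)) split (clash-free xs (fresh ∘ there)) x∉

    smaller-producible : ∀ {x xs S C} → Producible (x ∷ xs) t S → Producible xs t (C ∷ S)
    smaller-producible {xs = xs} {S} prod x∈ sub le =
      prod (there x∈) (sub ∘ there) (≤-trans le (≤-reflexive (sym (+-suc (length S) (length xs)))))

    eliminate : ∀ xs {S} → Unique xs → Fresh xs → Producible xs t S →
                length S + length xs < k → ⋁ (positives xs ++ t) ∈ S →
                Reachable S → Reachable (⋁ t ∷ S)
    eliminate [] _ _ _ _ C∈S = weaken λ { (here refl) → C∈S ; (there D∈) → D∈ }
    eliminate (x ∷ xs) {S} u@(_ ∷ u′) fresh prod small C∈S reach =
      weaken (λ { (here e) → here e ; (there D∈) → there (there D∈) })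
        (eliminate xs u′ (fresh ∘ there) (smaller-producible {C = ⋁ (positives xs ++ t)} prod)
          (≤-trans (≤-reflexive (cong suc (sym (+-suc (length S) (length xs))))) small) (here refl)
          (resolve-head u fresh id ∈-++⁺ˡ prod small C∈S reach))

    -- The block is nonempty because `t` can enter only through a resolution: there is no weakening
    -- rule.
    eliminate⁺ : ∀ x xs {S} → Unique (x ∷ xs) → Fresh (x ∷ xs) → Producible (x ∷ xs) t S →
                 length S + length (x ∷ xs) < k → ⋁ (positives (x ∷ xs)) ∈ S →
                 Reachable S → Reachable (⋁ t ∷ S)
    eliminate⁺ x xs {S} u@(_ ∷ u′) fresh prod small C∈S reach =
      weaken (λ { (here e) → here e ; (there D∈) → there (there D∈) })
        (eliminate xs u′ (fresh ∘ there) (smaller-producible {C = ⋁ (positives xs ++ t)} prod)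
          (≤-trans (≤-reflexive (cong suc (sym (+-suc (length S) (length xs))))) small) (here refl)
          (resolve-head u fresh ∈-++⁺ˡ id prod small C∈S reach))

-- Upper bound: pebbling recursively from the top

module Variables (d : ℕ) (G : PebblingDAG) where
  open PebblingDAG G

  owner : Fin (numVars d G) → Vertex
  owner x = List.lookup vertices (proj₁ (remQuot d x))

  bit : Fin (numVars d G) → Fin d
  bit x = proj₂ (remQuot {length vertices} d x)

  owner-var : ∀ v i → owner (var d G v i) ≡ v
  owner-var v i = trans (cong (List.lookup vertices ∘ proj₁) (Fin.remQuot-combine (index (complete v)) i))
                        (sym (lookup-index (complete v)))

  bit-var : ∀ v i → bit (var d G v i) ≡ i
  bit-var v i = cong proj₂ (Fin.remQuot-combine (index (complete v)) i)

  var-≢ : ∀ {u v i j} → u ≢ v → var d G u i ≢ var d G v j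
  var-≢ {u} {v} {i} {j} u≢v e = u≢v (trans (sym (owner-var u i)) (trans (cong owner e) (owner-var v j)))

  vars : Vertex → List (Fin (numVars d G))
  vars v = map (var d G v) (allFin d)

  vars-unique : ∀ v → Unique (vars v)
  vars-unique v = Unique.map⁺ (λ {i} {j} e → trans (sym (bit-var v i)) (trans (cong bit e) (bit-var v j)))
                              (Unique.allFin⁺ d)

  some-positives : ∀ v → some d G v ≡ map (_, true) (vars v)
  some-positives v = List.map-∘ (allFin d)

  ∈-some⁻ : ∀ v {l} → l ∈ some d G v → ∃[ i ] l ≡ pos (var d G v i)
  ∈-some⁻ v l∈ with i , _ , e ← ∈-map⁻ _ l∈ = i , e

  ∈-vars⁻ : ∀ v {x} → x ∈ vars v → ∃[ i ] x ≡ var d G v i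
  ∈-vars⁻ v x∈ with i , _ , e ← ∈-map⁻ _ x∈ = i , e

  some-consistent : ∀ v → Consistent (some d G v)
  some-consistent v p q = trans (cong proj₂ (proj₂ (∈-some⁻ v p))) (sym (cong proj₂ (proj₂ (∈-some⁻ v q))))

  var∉some : ∀ {u v} → u ≢ v → ∀ i b → (var d G u i , b) ∉ some d G v
  var∉some {v = v} u≢v i b p with _ , e ← ∈-some⁻ v p = var-≢ u≢v (cong proj₁ e)

  preds-≢ : ∀ {u v w} → preds w ≡ just (u , v) → u ≢ w × v ≢ w
  preds-≢ {u} {v} e = (λ { refl → acyclic [ v , inj₁ e ]⁺ }) , (λ { refl → acyclic [ u , inj₂ e ]⁺ })

  implication-consistent : ∀ {u v w} → preds w ≡ just (u , v) → ∀ i →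
                           Consistent (neg (var d G u i) ∷ some d G w)
  implication-consistent {w = w} e i = consistent-∷ (var∉some (proj₁ (preds-≢ e)) i) (some-consistent w)

  var∉implication : ∀ {u v w} → preds w ≡ just (u , v) → ∀ i j b →
                    (var d G v j , b) ∉ neg (var d G u i) ∷ some d G w
  var∉implication e i j b (here e′) = var-≢ (preds-distinct e ∘ sym) (cong proj₁ e′)
  var∉implication e i j b (there p) = var∉some (proj₂ (preds-≢ e)) j b p

  propagation-consistent : ∀ {u v w} → preds w ≡ just (u , v) → ∀ i j →
                           Consistent (neg (var d G u i) ∷ neg (var d G v j) ∷ some d G w)
  propagation-consistent {w = w} e i j = consistent-∷
    (λ { b (here e′) → var-≢ (preds-distinct e) (cong proj₁ e′)
       ; b (there p) → var∉some (proj₁ (preds-≢ e)) i b p })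
    (consistent-∷ (var∉some (proj₂ (preds-≢ e)) j) (some-consistent w))

  -- The axioms list `u` first, but the inner elimination in `propagate` is over `v` and wants the
  -- literal of `v` at the head.
  propagation-swap : ∀ {u v w} → preds w ≡ just (u , v) → ∀ i j →
    ⋁ (neg (var d G u i) ∷ neg (var d G v j) ∷ some d G w) ≡
    ⋁ (neg (var d G v j) ∷ neg (var d G u i) ∷ some d G w)
  propagation-swap {w = w} e i j = Vec.[]≔-commutes (⋁ (some d G w)) _ _ (var-≢ (preds-distinct e ∘ sym))

  vertexAxiom∈Peb : ∀ {w C} → C ∈ vertexAxioms d G w → C ∈ Peb d G
  vertexAxiom∈Peb {w} C∈ = ∈-++⁺ˡ (∈-concatMap⁺ (vertexAxioms d G) (lose (complete w) C∈))

  sinkAxiom∈Peb : ∀ i → ⋁ [ neg (var d G sink i) ] ∈ Peb d G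
  sinkAxiom∈Peb i = ∈-++⁺ʳ _ (∈-map⁺ _ (∈-allFin i))

  sourceAxiom : ∀ {w} → preds w ≡ nothing → ⋁ (some d G w) ∈ vertexAxioms d G w
  sourceAxiom {w} e rewrite e = here refl

  propagationAxiom : ∀ {u v w} → preds w ≡ just (u , v) → ∀ i j →
                     ⋁ (neg (var d G u i) ∷ neg (var d G v j) ∷ some d G w) ∈ vertexAxioms d G w
  propagationAxiom {w = w} e i j rewrite e =
    ∈-concatMap⁺ _ (lose (∈-allFin i) (∈-map⁺ _ (∈-allFin j)))

  vertexAxiom⁻ : ∀ w {C} → C ∈ vertexAxioms d G w →
    (preds w ≡ nothing × C ≡ ⋁ (some d G w)) ⊎
    ∃[ u ] ∃[ v ] ∃[ i ] ∃[ j ] (preds w ≡ just (u , v) ×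
      C ≡ ⋁ (neg (var d G u i) ∷ neg (var d G v j) ∷ some d G w))
  vertexAxiom⁻ w C∈ with preds w
  vertexAxiom⁻ w (here e) | nothing = inj₁ (refl , e)
  vertexAxiom⁻ w C∈ | just (u , v)
    with i , _ , C∈ᵢ ← find (∈-concatMap⁻ _ {xs = allFin d} C∈)
    with j , _ , e ← ∈-map⁻ _ C∈ᵢ = inj₂ (u , v , i , j , refl , e)

  module _ (k : ℕ) where
    private Reach = Reachable (Peb d G) k

    eliminate-some : ∀ v {t S} → 0 < d → Consistent t → (∀ i b → (var d G v i , b) ∉ t) →
                     (∀ i {S′} → S ⊆ S′ → length S′ ≤ length S + d →
                        Reach S′ → Reach (⋁ (neg (var d G v i) ∷ t) ∷ S′)) →
                     length S + d < k → ⋁ (some d G v) ∈ S → Reach S → Reach (⋁ t ∷ S)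
    eliminate-some v {t} {S} 0<d con fresh prod small C∈S reach = go (vars v) refl
      where
      len : length (vars v) ≡ d
      len = trans (List.length-map _ (allFin d)) (List.length-tabulate id)
      -- Generalising `vars v` allows a split into head and tail; the empty case is excluded by
      -- `0 < d`.
      go : ∀ xs → xs ≡ vars v → Reach (⋁ t ∷ S)
      go [] e = contradiction (trans (cong length e) len) (<⇒≢ 0<d)
      go (x ∷ xs) e = eliminate⁺ (Peb d G) k con x xs (subst Unique (sym e) (vars-unique v))
        (λ {y} x∈ b → case ∈-vars⁻ v (subst (y ∈_) e x∈) of λ { (i , refl) → fresh i b })
        (λ {y} x∈ sub le → case ∈-vars⁻ v (subst (y ∈_) e x∈) of λ
           { (i , refl) → prod i sub (≤-trans le (≤-reflexive (cong (length S +_) len′))) })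
        (subst (λ m → length S + m < k) (sym len′) small)
        (subst (λ ls → ⋁ ls ∈ S) (trans (some-positives v) (cong (map (_, true)) (sym e))) C∈S)
        reach
        where
        len′ : length (x ∷ xs) ≡ d
        len′ = trans (cong length e) len

    -- Two nested eliminations: the outer one removes the variables of `u`, and each of its side
    -- clauses comes from removing the variables of `v` with the help of axioms. Each nesting holds
    -- at most `d` auxiliary clauses, whence `d + d`.
    propagate : ∀ {u v w S} → 0 < d → preds w ≡ just (u , v) → length S + (d + d) < k →
                ⋁ (some d G u) ∈ S → ⋁ (some d G v) ∈ S → Reach S → Reach (⋁ (some d G w) ∷ S)
    propagate {u} {v} {w} {S} 0<d e small u∈ v∈ reach =
      eliminate-some u 0<d (some-consistent w) (var∉some (proj₁ (preds-≢ e))) produce-u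
        (≤-trans (s≤s (+-monoʳ-≤ (length S) (m≤m+n d d))) small) u∈ reach
      where
      produce-u : ∀ i {S′} → S ⊆ S′ → length S′ ≤ length S + d → Reach S′ →
                  Reach (⋁ (neg (var d G u i) ∷ some d G w) ∷ S′)
      produce-u i {S′} sub le =
        eliminate-some v 0<d (implication-consistent e i) (var∉implication e i) produce-v small′ (sub v∈)
        where
        small′ : length S′ + d < k
        small′ = ≤-trans (s≤s (≤-trans (+-monoˡ-≤ d le) (≤-reflexive (+-assoc (length S) d d)))) small
        produce-v : ∀ j {S″} → S′ ⊆ S″ → length S″ ≤ length S′ + d → Reach S″ →
                    Reach (⋁ (neg (var d G v j) ∷ neg (var d G u i) ∷ some d G w) ∷ S″)
        produce-v j {S″} _ le″ = reach-axiom (Peb d G) k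
          (subst (_∈ Peb d G) (propagation-swap e i j) (vertexAxiom∈Peb {w} (propagationAxiom e i j)))
          (≤-trans (s≤s le″) small′)

    refute-from-sink : 0 < d → d + 1 < k → Reach [ ⋁ (some d G sink) ] → RefutableIn (Peb d G) k
    refute-from-sink 0<d small reach = reachable𝟘⇒refutable (Peb d G) k
      (weaken (Peb d G) k (λ { (here e) → here e })
        (eliminate-some sink {[]} 0<d (λ ()) (λ _ _ ())
          (λ i {S′} _ le → reach-axiom (Peb d G) k (sinkAxiom∈Peb i) (≤-trans (s≤s le) small′))
          small′ (here refl) reach))
      where
      small′ : 1 + d < k
      small′ = subst (_< k) (+-comm d 1) small

module Upper (d h : ℕ) (0<d : 0 < d) where
  open Variables d (pyramid h)

  -- Each level keeps one clause, that of the left predecessor, while the right one is derived. A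
  -- propagation adds the clauses of both predecessors, `d + d` auxiliary ones and room for the
  -- clause about to be written.
  pyramid-space : ℕ
  pyramid-space = h + (3 + (d + d))

  derive : ∀ L i .(b : L + i ≤ h) {S} → length S + (L + (3 + (d + d))) ≤ pyramid-space →
           Reachable (Peb d (pyramid h)) pyramid-space S →
           Reachable (Peb d (pyramid h)) pyramid-space (⋁ (some d (pyramid h) (vertex L i b)) ∷ S)
  derive zero i b {S} small = reach-axiom _ _ (vertexAxiom∈Peb {vertex zero i b} (sourceAxiom {vertex zero i b} refl))
    (≤-trans (≤-trans (≤-reflexive (+-comm 1 (length S))) (+-monoʳ-≤ (length S) (s≤s z≤n))) small)
  derive (suc L) i b {S} small reach =
    weaken _ _ (λ { (here e) → here e ; (there C∈) → there (there (there C∈)) })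
      (propagate _ {w = vertex (suc L) i b} 0<d refl small″ (there (here refl)) (here refl)
        (derive L (suc i) _ small′ (derive L i _ (≤-trans (+-monoʳ-≤ (length S) (n≤1+n _)) small) reach)))
    where
    c = 3 + (d + d)
    small′ : suc (length S) + (L + c) ≤ pyramid-space
    small′ = ≤-trans (≤-reflexive (sym (+-suc (length S) (L + c)))) small
    3+ : ∀ m n → 3 + (m + n) ≡ m + (3 + n)
    3+ = solve-∀
    small″ : suc (suc (length S)) + (d + d) < pyramid-space
    small″ = ≤-trans (≤-reflexive (3+ (length S) (d + d)))
              (≤-trans (+-monoʳ-≤ (length S) (m≤n+m c (suc L))) small)

  refutable : RefutableIn (Peb d (pyramid h)) pyramid-space
  refutable = refute-from-sink pyramid-space 0<d
    (≤-trans (s≤s (≤-trans (≤-reflexive (+-comm d 1)) (s≤s (≤-trans (m≤m+n d d) (n≤1+n (d + d)))))) (m≤n+m _ h))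
    (derive h 0 _ ≤-refl ([] , ε , id , id))

-- Hiding sets in the pyramid

module _ {A : Set} {P Q : A → Set} (P? : Decidable₁ P) (Q? : Decidable₁ Q) where

  length-partition : ∀ xs → length (filter Q? (filter P? xs)) + length (filter Q? (filter (¬? ∘ P?) xs))
                            ≡ length (filter Q? xs)
  length-partition [] = refl
  length-partition (x ∷ xs) with P? x
  ... | yes _ with Q? x
  ...   | yes _ = cong suc (length-partition xs)
  ...   | no  _ = length-partition xs
  length-partition (x ∷ xs) | no _ with Q? x
  ...   | yes _ = trans (+-suc _ _) (cong suc (length-partition xs))
  ...   | no  _ = length-partition xs

length-filter-++ : ∀ {A : Set} {P : A → Set} (P? : Decidable₁ P) xs ys →
                   length (filter P? (xs ++ ys)) ≡ length (filter P? xs) + length (filter P? ys)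
length-filter-++ P? xs ys = trans (cong length (List.filter-++ P? xs ys)) (List.length-++ (filter P? xs))

length-split : ∀ {A : Set} {P : A → Set} (P? : Decidable₁ P) xs →
               length (filter P? xs) + length (filter (¬? ∘ P?) xs) ≡ length xs
length-split P? [] = refl
length-split P? (x ∷ xs) with P? x
... | yes _ = cong suc (length-split P? xs)
... | no  _ = trans (+-suc _ _) (cong suc (length-split P? xs))

length-filter-mono : ∀ {A : Set} {P Q : A → Set} (P? : Decidable₁ P) (Q? : Decidable₁ Q) →
                     (∀ {x} → P x → Q x) → ∀ xs → length (filter P? xs) ≤ length (filter Q? xs)
length-filter-mono P? Q? P⇒Q [] = z≤n
length-filter-mono P? Q? P⇒Q (x ∷ xs) with P? x | Q? x
... | yes _ | yes _ = s≤s (length-filter-mono P? Q? P⇒Q xs)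
... | yes p | no ¬q = contradiction (P⇒Q p) ¬q
... | no  _ | yes _ = m≤n⇒m≤1+n (length-filter-mono P? Q? P⇒Q xs)
... | no  _ | no  _ = length-filter-mono P? Q? P⇒Q xs

0<length⇒∃ : ∀ {A : Set} {P : A → Set} (P? : Decidable₁ P) xs → 0 < length (filter P? xs) → ∃[ x ] (x ∈ xs × P x)
0<length⇒∃ P? xs p with filter P? xs in eq
... | y ∷ _ = y , ∈-filter⁻ P? (subst (y ∈_) (sym eq) (here refl))

∃-minimal : ∀ {A : Set} (f : A → ℕ) {x : A} {xs} → x ∈ xs → ∃[ m ] (m ∈ xs × (∀ {y} → y ∈ xs → f m ≤ f y))
∃-minimal f {xs = x ∷ []} _ = x , here refl , λ { (here refl) → ≤-refl }
∃-minimal f {xs = x ∷ xs@(_ ∷ _)} _ with m , m∈ , min ← ∃-minimal f {xs = xs} (here refl) | f x ≤? f m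
... | yes x≤m = x , here refl , λ { (here refl) → ≤-refl ; (there y∈) → ≤-trans x≤m (min y∈) }
... | no  x≰m = m , there m∈ , λ { (here refl) → <⇒≤ (≰⇒> x≰m) ; (there y∈) → min y∈ }

module _ {K : Set} (_≟_ : DecidableEquality K) where

  multiplicity : K → List K → ℕ
  multiplicity k = length ∘ filter (_≟ k)

  multiplicity-∷ : ∀ k x xs → multiplicity k (x ∷ xs) ≡ multiplicity k [ x ] + multiplicity k xs
  multiplicity-∷ k x xs = length-filter-++ (_≟ k) [ x ] xs

  -- Multiset inclusion: each head of `xs` is matched with an occurrence in `ys`, which is then
  -- removed. Values outside `xs` have multiplicity zero, so the hypothesis extends to all `k`.
  multiplicity-≤⇒length-≤ : ∀ xs ys → (∀ {k} → k ∈ xs → multiplicity k xs ≤ multiplicity k ys) →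
                            length xs ≤ length ys
  multiplicity-≤⇒length-≤ xs ys le = go xs ys le′
    where
    le′ : ∀ k → multiplicity k xs ≤ multiplicity k ys
    le′ k with any? (k ≟_) xs
    ... | yes k∈ = le k∈
    ... | no  k∉ = ≤-trans (≤-reflexive (cong length (List.filter-none (_≟ k)
                     (All.tabulate λ x∈ x≡k → k∉ (Any.map (λ x≡y → trans (sym x≡k) x≡y) x∈))))) z≤n
    go : ∀ xs ys → (∀ k → multiplicity k xs ≤ multiplicity k ys) → length xs ≤ length ys
    go []       ys le = z≤n
    go (x ∷ xs) ys le
      with _ , x∈ys , refl ← 0<length⇒∃ (_≟ x) ys
             (≤-trans (List.filter-some (_≟ x) {x ∷ xs} (here refl)) (le x))
      with as , bs , refl ← ∈-∃++ x∈ys =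
      ≤-trans (s≤s (go xs (as ++ bs) λ k → +-cancelˡ-≤ (multiplicity k [ x ]) _ _ (rest k)))
        (≤-reflexive (sym (trans (List.length-++ as) (trans (+-suc _ _) (cong suc (sym (List.length-++ as)))))))
      where
      rest : ∀ k → multiplicity k [ x ] + multiplicity k xs ≤ multiplicity k [ x ] + multiplicity k (as ++ bs)
      rest k = begin
        multiplicity k [ x ] + multiplicity k xs            ≡⟨ multiplicity-∷ k x xs ⟨
        multiplicity k (x ∷ xs)                             ≤⟨ le k ⟩
        multiplicity k (as ++ x ∷ bs)                       ≡⟨ length-filter-++ (_≟ k) as (x ∷ bs) ⟩
        multiplicity k as + multiplicity k (x ∷ bs)         ≡⟨ cong (multiplicity k as +_) (multiplicity-∷ k x bs) ⟩
        multiplicity k as + (multiplicity k [ x ] + multiplicity k bs) ≡⟨ swap (multiplicity k as) (multiplicity k [ x ]) _ ⟩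
        multiplicity k [ x ] + (multiplicity k as + multiplicity k bs)
                                                            ≡⟨ cong (multiplicity k [ x ] +_) (length-filter-++ (_≟ k) as bs) ⟨
        multiplicity k [ x ] + multiplicity k (as ++ bs)    ∎
        where
        open ≤-Reasoning
        swap : ∀ a b c → a + (b + c) ≡ b + (a + c)
        swap = solve-∀

  multiplicity-map : ∀ {A : Set} (f : A → K) k xs → multiplicity k (map f xs) ≡ length (filter (λ x → f x ≟ k) xs)
  multiplicity-map f k [] = refl
  multiplicity-map f k (x ∷ xs) with f x ≟ k
  ... | yes _ = cong suc (multiplicity-map f k xs)
  ... | no  _ = multiplicity-map f k xs

Covers : {A : Set} → (A → ℕ) → List A → ℕ → ℕ → Set
Covers f xs a b = ∀ m → a ≤ m → m < b → ∃[ x ] (x ∈ xs × f x ≡ m)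

-- Discarding all elements with the top value costs at least one element and keeps the smaller
-- values covered.
covers-length : ∀ {A : Set} (f : A → ℕ) xs a b → Covers f xs a b → b ≤ a + length xs
covers-length f xs a zero _ = z≤n
covers-length f xs a (suc b) cov with a ≤? b
... | no  a≰b = ≤-trans (≰⇒> a≰b) (m≤m+n a _)
... | yes a≤b with x , x∈ , fx≡b ← cov b a≤b ≤-refl =
  ≤-trans (s≤s (covers-length f xs′ a b cov′))
    (≤-trans (≤-reflexive (sym (+-suc a _)))
      (+-monoʳ-≤ a (List.filter-notAll (λ y → ¬? (f y ≟ b)) xs (lose x∈ λ ¬p → ¬p fx≡b))))
  where
  xs′ = filter (λ y → ¬? (f y ≟ b)) xs
  cov′ : Covers f xs′ a b
  cov′ m a≤m m<b with y , y∈ , refl ← cov m a≤m (m<n⇒m<1+n m<b) =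
    y , ∈-filter⁺ _ y∈ (<⇒≢ m<b) , refl

covers-⊆ : ∀ {A : Set} {f : A → ℕ} {xs ys a b} → xs ⊆ ys → Covers f xs a b → Covers f ys a b
covers-⊆ sub cov m a≤m m<b = let x , x∈ , e = cov m a≤m m<b in x , sub x∈ , e

covers-trans : ∀ {A : Set} {f : A → ℕ} {xs} a b c → Covers f xs a b → Covers f xs b c → Covers f xs a c
covers-trans a b c p q m a≤m m<c with m <? b
... | yes m<b = p m a≤m m<b
... | no  m≮b = q m (≮⇒≥ m≮b) m<c

covers-empty : ∀ {A : Set} {f : A → ℕ} {xs a} → Covers f xs a a
covers-empty m a≤m m<a = contradiction a≤m (<⇒≱ m<a)

module Hiding (G : PebblingDAG) where
  open PebblingDAG G

  -- Hidden E v: every path from a source to v meets E.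

  data Hidden (E : List Vertex) : Vertex → Set where
    blocked : ∀ {v} → v ∈ E → Hidden E v
    join    : ∀ {u v w} → preds w ≡ just (u , v) → Hidden E u → Hidden E v → Hidden E w

  hidden-⊆ : ∀ {E E′ v} → E ⊆ E′ → Hidden E v → Hidden E′ v
  hidden-⊆ sub (blocked v∈) = blocked (sub v∈)
  hidden-⊆ sub (join e p q) = join e (hidden-⊆ sub p) (hidden-⊆ sub q)

  -- Modelled on black-white pebbling: the apex acts as a black pebble that depends on the white
  -- ones.
  record Constraint : Set where
    constructor _⟨_⟩
    field
      apex   : Vertex
      whites : List Vertex

  open Constraint public

  Holds : List Vertex → Constraint → Set
  Holds U c = Hidden (U ++ whites c) (apex c)

-- The vertex (L, i) is identified with the interval [i, L + i] of the
-- sources below it; the predecessors of [a, c] are [a, c - 1] and [a + 1, c].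

module Geometry (h : ℕ) where

  V : Set
  V = PyramidVertex h

  open PyramidVertex public using (level)

  left right : V → ℕ
  left v  = PyramidVertex.position v
  right v = level v + PyramidVertex.position v

  _≟ⱽ_ : DecidableEquality V
  vertex L i b ≟ⱽ vertex L′ i′ b′ =
    map′ (λ (p , q) → Pyramid.vertex-cong h p q) (λ { refl → refl , refl }) (L ≟ L′ ×-dec i ≟ i′)

  open import Data.List.Membership.DecPropositional _≟ⱽ_ public using () renaming (_∈?_ to _∈ⱽ?_)

  open Hiding (pyramid h) public

  hidden? : ∀ E v → Dec (Hidden E v)
  hidden? E (vertex L i b) = go L i b
    where
    go : ∀ L i .(b : L + i ≤ h) → Dec (Hidden E (vertex L i b))
    go L i b with vertex L i b ∈ⱽ? E
    go L i b | yes v∈ = yes (blocked v∈)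
    go zero i b | no v∉ = no λ { (blocked v∈) → v∉ v∈ ; (join () _ _) }
    go (suc L) i b | no v∉ = map′ (λ (p , q) → join refl p q)
      (λ { (blocked v∈) → contradiction v∈ v∉ ; (join refl p q) → p , q })
      (go L i _ ×-dec go L (suc i) _)

  -- A hiding set without gaps: its left ends form an interval beginning at `left v`, its right ends
  -- one ending at `right v`. By `level-gap`, `v` is then above any element of `E` by at most twice
  -- the size of `E`.
  record Spread (E : List V) (v : V) : Set where
    field
      hidden    : Hidden E v
      some-left : ∃[ e ] (e ∈ E × left e ≡ left v)
      some-right : ∃[ e ] (e ∈ E × right e ≡ right v)
      left≤     : ∀ {x} → x ∈ E → left v ≤ left x
      ≤right    : ∀ {x} → x ∈ E → right x ≤ right v
      lefts     : ∀ {x} → x ∈ E → Covers left E (left v) (left x)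
      rights    : ∀ {x} → x ∈ E → Covers right E (suc (right x)) (suc (right v))

  open Spread

  -- Induction on `Hidden`, uniting the sets of the two predecessors. Their left ends start at `i`
  -- and `i + 1`, so in front of the second set only `i` could be missing, and the first set
  -- supplies it. Right ends are symmetric.
  spread : ∀ {E v} → Hidden E v → ∃[ E′ ] (E′ ⊆ E × Spread E′ v)
  spread {v = v} (blocked v∈) = [ v ] , (λ { (here refl) → v∈ }) , record
    { hidden = blocked (here refl)
    ; some-left = v , here refl , refl
    ; some-right = v , here refl , refl
    ; left≤ = λ { (here refl) → ≤-refl }
    ; ≤right = λ { (here refl) → ≤-refl }
    ; lefts = λ { (here refl) → covers-empty }
    ; rights = λ { (here refl) → covers-empty }
    }
  spread {v = vertex zero i b} (join () _ _)
  spread {v = vertex (suc L) i b} (join refl p q) with E₁ , E₁⊆ , s ← spread p | E₂ , E₂⊆ , t ← spread q =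
    E₁ ++ E₂ , [ E₁⊆ , E₂⊆ ]′ ∘ ∈-++⁻ E₁ , record
    { hidden = join refl (hidden-⊆ ∈-++⁺ˡ (hidden s)) (hidden-⊆ (∈-++⁺ʳ E₁) (hidden t))
    ; some-left = firstLeft
    ; some-right = lastRight
    ; left≤ = λ {x} x∈ → [ left≤ s , (λ x∈ → ≤-trans (n≤1+n i) (left≤ t {x} x∈)) ]′ (∈-++⁻ E₁ x∈)
    ; ≤right = λ {x} x∈ → [ (λ x∈ → m≤n⇒m≤1+n (≤right s x∈))
                      , (λ x∈ → ≤-trans (≤right t {x} x∈) (≤-reflexive (+-suc L i))) ]′ (∈-++⁻ E₁ x∈)
    ; lefts = λ {x} x∈ → case ∈-++⁻ E₁ x∈ of λ
        { (inj₁ x∈) → covers-⊆ ∈-++⁺ˡ (lefts s x∈)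
        ; (inj₂ x∈) → covers-trans i (suc i) (left x) (single firstLeft)
                        (covers-⊆ (∈-++⁺ʳ E₁) (lefts t x∈)) }
    ; rights = λ {x} x∈ → case ∈-++⁻ E₁ x∈ of λ
        { (inj₁ x∈) → covers-trans (suc (right x)) (suc (L + i)) (suc (suc (L + i)))
                        (covers-⊆ ∈-++⁺ˡ (rights s x∈)) (single lastRight)
        ; (inj₂ x∈) → covers-⊆ (∈-++⁺ʳ E₁)
                        (subst (Covers right E₂ (suc (right x)) ∘ suc) (+-suc L i) (rights t x∈)) }
    }
    where
    single : ∀ {f : V → ℕ} {n} → ∃[ e ] (e ∈ E₁ ++ E₂ × f e ≡ n) → Covers f (E₁ ++ E₂) n (suc n)
    single (e , e∈ , eq) m n≤m (s≤s m≤n) = e , e∈ , trans eq (≤-antisym n≤m m≤n)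
    firstLeft : ∃[ e ] (e ∈ E₁ ++ E₂ × left e ≡ i)
    firstLeft = let e , e∈ , eq = some-left s in e , ∈-++⁺ˡ e∈ , eq
    lastRight : ∃[ e ] (e ∈ E₁ ++ E₂ × right e ≡ suc (L + i))
    lastRight = let e , e∈ , eq = some-right t in e , ∈-++⁺ʳ E₁ e∈ , trans eq (+-suc L i)

  atLevel : ℕ → List V → ℕ
  atLevel j = length ∘ filter (λ v → j ≤? level v)

  -- Klawe's measure: Potential M U says max { j + 4 |U{≥ j}| } ≤ M, the
  -- maximum being over those j for which U{≥ j} is nonempty.

  Potential : ℕ → List V → Set
  Potential M U = ∀ j → 0 < atLevel j U → j + 4 * atLevel j U ≤ M

  -- A level is right end minus left end, so moving each end outwards by at most `m` raises it by at
  -- most `2 * m`. The hypotheses have the shape that `covers-length` returns.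
  level-gap : ∀ r x m → left x ≤ left r + m → suc (right r) ≤ suc (right x) + m → level r ≤ level x + 2 * m
  level-gap r x m p (s≤s q) = +-cancelʳ-≤ (left r) (level r) (level x + 2 * m) (begin
    level r + left r           ≤⟨ q ⟩
    level x + left x + m       ≤⟨ +-monoˡ-≤ m (+-monoʳ-≤ (level x) p) ⟩
    level x + (left r + m) + m ≡⟨ eq (level x) (left r) m ⟩
    level x + 2 * m + left r   ∎)
    where
    open ≤-Reasoning
    eq : ∀ a b c → a + (b + c) + c ≡ a + 2 * c + b
    eq = solve-∀

  -- The potential is evaluated at the level of the lowest vertex `x` of a gap-free hiding subset,
  -- all of which is then counted.
  hidden-sink⇒tall : ∀ {M U} → Potential M U → Hidden U (Pyramid.sink h) → h ≤ M
  hidden-sink⇒tall {M} {U} pot hid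
    with E , E⊆U , s ← spread hid
    with e , e∈ , _ ← some-left s
    with x , x∈ , min ← ∃-minimal level e∈ = begin
    h                      ≤⟨ level-gap (Pyramid.sink h) x m
                                (covers-length left Z 0 (left x) (covers-⊆ E⊆Z (lefts s x∈)))
                                (covers-length right Z _ _ (covers-⊆ E⊆Z (rights s x∈))) ⟩
    -- The factor is relaxed to the 4 that the exchange in `replace-potential` works with.
    level x + 2 * m        ≤⟨ +-monoʳ-≤ (level x) (*-monoˡ-≤ m {2} {4} (s≤s (s≤s z≤n))) ⟩
    level x + 4 * m        ≤⟨ pot (level x) (List.filter-some _ (lose (E⊆U x∈) ≤-refl)) ⟩
    M                      ∎
    where
    open ≤-Reasoning
    Z = filter (λ v → level x ≤? level v) U
    m = length Z
    E⊆Z : E ⊆ Z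
    E⊆Z y∈ = ∈-filter⁺ _ (E⊆U y∈) (min y∈)

-- Shrinking a hiding set

module Reduction (h : ℕ) where
  open Geometry h
  open Spread

  module _ (U Y : List V) where

    record Support : Set where
      field
        con      : Constraint
        whites⊆Y : whites con ⊆ Y
        els      : List V
        els⊆     : els ⊆ U ++ whites con
        isSpread : Spread els (apex con)

      -- A representative element of the support, from which its colour is read off.
      pick : V
      pick = proj₁ (some-left isSpread)

      pick∈ : pick ∈ els
      pick∈ = proj₁ (proj₂ (some-left isSpread))

      els⊆U++Y : els ⊆ U ++ Y
      els⊆U++Y x∈ with ∈-++⁻ U (els⊆ x∈)
      ... | inj₁ x∈U = ∈-++⁺ˡ x∈U
      ... | inj₂ x∈W = ∈-++⁺ʳ U (whites⊆Y x∈W)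

    open Support

    supports : ∀ cs → (∀ {c} → c ∈ cs → Holds U c × whites c ⊆ Y) →
               ∃[ ss ] (length ss ≡ length cs × (∀ {c} → c ∈ cs → ∃[ s ] (s ∈ ss × con s ≡ c)))
    supports [] _ = [] , refl , λ ()
    supports (c ∷ cs) hyp
      with ss , len , all ← supports cs (hyp ∘ there)
      with hid , W⊆Y ← hyp (here refl)
      with E , E⊆ , sp ← spread hid =
      s ∷ ss , cong suc len , λ { (here refl) → s , here refl , refl
                                ; (there c∈) → let s′ , s∈ , e = all c∈ in s′ , there s∈ , e }
      where s = record { con = c ; whites⊆Y = W⊆Y ; els = E ; els⊆ = E⊆ ; isSpread = sp }

    -- Colour classes have no gaps: what lies between the ends of `x` and `y` is filled by vertices
    -- of `U ++ Y` of their own colour. The orientation is the one needed to descend from a wide `y`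
    -- to a narrow `x`; the other is obtained by exchanging them.
    Linked : (V → V) → Set
    Linked κ = ∀ x y → κ x ≡ κ y →
      Covers left (class (κ x)) (left y) (left x) ×
      Covers right (class (κ x)) (suc (right x)) (suc (right y))
      where
      class : V → List V
      class k = filter (λ v → κ v ≟ⱽ k) (U ++ Y)

    Monochrome : (V → V) → Support → Set
    Monochrome κ s = ∀ {x} → x ∈ els s → κ x ≡ κ (pick s)

    -- The classes met by a new support are merged; no gap arises between them,
    -- because the end points of the support itself have no gaps.

    colouring : ∀ ss → ∃[ κ ] (Linked κ × (∀ {s} → s ∈ ss → Monochrome κ s))
    colouring [] = id , (λ { x .x refl → covers-empty , covers-empty }) , λ ()
    colouring (s ∷ ss) with κ , linked , mono ← colouring ss = κ′ , linked′ , mono′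
      where
      E = els s
      Touched : V → Set
      Touched k = Any.Any (λ e → k ≡ κ e) E
      touched? : ∀ k → Dec (Touched k)
      touched? k = any? (λ e → k ≟ⱽ κ e) E
      recolour : V → V
      recolour k with touched? k
      ... | yes _ = κ (pick s)
      ... | no  _ = k
      recolour-touched : ∀ {k} → Touched k → recolour k ≡ κ (pick s)
      recolour-touched {k} t with touched? k
      ... | yes _ = refl
      ... | no ¬t = contradiction t ¬t
      recolour-untouched : ∀ {k} → ¬ Touched k → recolour k ≡ k
      recolour-untouched {k} ¬t with touched? k
      ... | yes t = contradiction t ¬t
      ... | no _  = refl
      κ′ = recolour ∘ κ
      class class′ : V → List V
      class  k = filter (λ v → κ v ≟ⱽ k) (U ++ Y)
      class′ k = filter (λ v → κ′ v ≟ⱽ k) (U ++ Y)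
      touched-els : ∀ {x} → x ∈ E → Touched (κ x)
      touched-els x∈ = lose x∈ refl
      mono′ : ∀ {s′} → s′ ∈ s ∷ ss → Monochrome κ′ s′
      mono′ (here refl) x∈ = trans (recolour-touched (touched-els x∈)) (sym (recolour-touched (touched-els (pick∈ s))))
      mono′ (there s∈)  x∈ = cong recolour (mono s∈ x∈)
      class⊆ : ∀ {x k} → recolour (κ x) ≡ k → class (κ x) ⊆ class′ k
      class⊆ e y∈ with y∈X , κy≡ ← ∈-filter⁻ _ {xs = U ++ Y} y∈ = ∈-filter⁺ _ y∈X (trans (cong recolour κy≡) e)
      E⊆class : E ⊆ class′ (κ (pick s))
      E⊆class y∈ = ∈-filter⁺ _ (els⊆U++Y s y∈) (recolour-touched (touched-els y∈))
      covers-from : ∀ {A : Set} {f : A → ℕ} {xs a b c} → a ≤ b → Covers f xs a c → Covers f xs b c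
      covers-from a≤b cov m b≤m = cov m (≤-trans a≤b b≤m)
      covers-upto : ∀ {A : Set} {f : A → ℕ} {xs a b c} → b ≤ c → Covers f xs a c → Covers f xs a b
      covers-upto b≤c cov m a≤m m<b = cov m a≤m (≤-trans m<b b≤c)
      linked′ : Linked κ′
      linked′ x y e with touched? (κ x) | touched? (κ y)
      ... | no ¬t | no ¬t′ = covers-⊆ sub (proj₁ ℓ) , covers-⊆ sub (proj₂ ℓ)
        where
        ℓ = linked x y e
        sub = class⊆ {x} (recolour-untouched ¬t)
      -- The merged class takes the colour `κ (pick s)`, which was itself touched, so no untouched
      -- class can share it.
      ... | yes t | no ¬t′ = contradiction (subst Touched e (touched-els (pick∈ s))) ¬t′
      ... | no ¬t | yes t′ = contradiction (subst Touched (sym e) (touched-els (pick∈ s))) ¬t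
      -- For left ends the chain runs from `y` to `e₂` in the old class of `y`, on to `e₁` within
      -- the support, and to `x` in the old class of `x`. Right ends take the reverse route.
      ... | yes t | yes t′
        with e₁ , e₁∈ , κx≡ ← find t | e₂ , e₂∈ , κy≡ ← find t′ =
          covers-trans (left y) (left e₂) (left x)
            (covers-⊆ (class⊆ {e₂} (recolour-touched (touched-els e₂∈))) (proj₁ (linked e₂ y (sym κy≡))))
            (covers-trans (left e₂) (left e₁) (left x)
              (covers-⊆ E⊆class (covers-from (left≤ sp e₂∈) (lefts sp e₁∈)))
              (covers-⊆ (class⊆ {x} (recolour-touched t)) (proj₁ (linked x e₁ κx≡))))
        , covers-trans (suc (right x)) (suc (right e₁)) (suc (right y))
            (covers-⊆ (class⊆ {x} (recolour-touched t)) (proj₂ (linked x e₁ κx≡)))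
            (covers-trans (suc (right e₁)) (suc (right e₂)) (suc (right y))
              (covers-⊆ E⊆class (covers-upto (s≤s (≤right sp e₂∈)) (rights sp e₁∈)))
              (covers-⊆ (class⊆ {e₂} (recolour-touched (touched-els e₂∈))) (proj₂ (linked e₂ y (sym κy≡)))))
        where sp = isSpread s

    module _ {ss : List Support} (κ : V → V) (linked : Linked κ)
             (mono : ∀ {s} → s ∈ ss → Monochrome κ s) (k : V) where

      coloured : List V → List V
      coloured = filter (λ v → κ v ≟ⱽ k)

      apexes : List V
      apexes = map (apex ∘ con) (filter (λ s → κ (pick s) ≟ⱽ k) ss)

      Uᵏ Uʳ U′ : List V
      Uᵏ = coloured U
      Uʳ = filter (λ v → ¬? (κ v ≟ⱽ k)) U
      U′ = Uʳ ++ apexes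

      -- The gap-free support leads from the apex `r` to its element `p`, and the linked class from
      -- `p` to `x`. All vertices on the way have colour `k`, so their number in `U ++ Y` bounds
      -- both displacements.
      apex-level : ∀ {r x} → r ∈ apexes → κ x ≡ k → level r ≤ level x + 2 * (length Uᵏ + length (coloured Y))
      apex-level {x = x} r∈ κx≡k with s , s∈ , refl ← ∈-map⁻ (apex ∘ con) r∈ with s∈ss , refl ← ∈-filter⁻ _ {xs = ss} s∈ =
        subst (λ m → level r ≤ level x + 2 * m) (length-filter-++ (λ v → κ v ≟ⱽ κ p) U Y)
          (level-gap r x (length X)
            (covers-length left X _ _ (covers-trans (left r) (left p) (left x)
              (covers-⊆ E⊆X (lefts sp (pick∈ s))) (subst (λ k → Covers left (class k) _ _) κx≡k (proj₁ (linked x p κx≡k)))))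
            (covers-length right X _ _ (covers-trans (suc (right x)) (suc (right p)) (suc (right r))
              (subst (λ k → Covers right (class k) _ _) κx≡k (proj₂ (linked x p κx≡k)))
              (covers-⊆ E⊆X (rights sp (pick∈ s))))))
        where
        sp = isSpread s
        r = apex (con s)
        p = pick s
        class : V → List V
        class k = filter (λ v → κ v ≟ⱽ k) (U ++ Y)
        X = class (κ p)
        E⊆X : els s ⊆ X
        E⊆X y∈ = ∈-filter⁺ _ (els⊆U++Y s y∈) (mono s∈ss y∈)

      -- A support of colour `k` has its apex added to `U′`; a support of another colour loses no
      -- vertex.
      replace-holds : ∀ {s} → s ∈ ss → Holds U′ (con s)
      replace-holds {s} s∈ with κ (pick s) ≟ⱽ k
      ... | yes e = blocked (∈-++⁺ˡ (∈-++⁺ʳ Uʳ (∈-map⁺ _ (∈-filter⁺ _ s∈ e))))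
      ... | no ¬e = hidden-⊆ sub (hidden (isSpread s))
        where
        sub : els s ⊆ U′ ++ whites (con s)
        sub x∈ with ∈-++⁻ U (els⊆ s x∈)
        ... | inj₁ x∈U = ∈-++⁺ˡ (∈-++⁺ˡ (∈-filter⁺ _ x∈U λ κx≡k → ¬e (trans (sym (mono s∈ x∈)) κx≡k)))
        ... | inj₂ x∈W = ∈-++⁺ʳ U′ x∈W

      module _ (heavy : length (coloured Y) + 2 * length apexes ≤ length Uᵏ) where

        replace-shorter : ∀ {u} → u ∈ U → κ u ≡ k → length U′ < length U
        replace-shorter u∈U κu≡k = begin-strict
          length U′                      ≡⟨ List.length-++ Uʳ ⟩
          length Uʳ + length apexes      <⟨ +-monoʳ-< (length Uʳ) (go (length apexes) heavy′) ⟩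
          length Uʳ + length Uᵏ          ≡⟨ +-comm (length Uʳ) _ ⟩
          length Uᵏ + length Uʳ          ≡⟨ length-split (λ v → κ v ≟ⱽ k) U ⟩
          length U                       ∎
          where
          open ≤-Reasoning
          heavy′ : 2 * length apexes ≤ length Uᵏ
          heavy′ = m+n≤o⇒n≤o (length (coloured Y)) heavy
          go : ∀ a → 2 * a ≤ length Uᵏ → a < length Uᵏ
          go zero    _  = List.filter-some _ (lose u∈U κu≡k)
          go (suc a) le = ≤-trans (s≤s (≤-trans (≤-reflexive (+-comm 1 a)) (+-monoʳ-≤ a (s≤s z≤n)))) le

        -- If no apex reaches level `i`, the count there does not grow. Otherwise it is compared
        -- with that of `U` at a lower level `l`, where all `D` vertices of the class count. By
        -- `apex-level`, `i` exceeds `l` by at most `2 * (D + y)`, and heaviness, `y + 2 * a ≤ D`,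
        -- lets the `4 * D` gained pay for this and for `4 * a`.
        replace-potential : ∀ {M u} → u ∈ U → κ u ≡ k → Potential M U → Potential M U′
        replace-potential {M} u∈U κu≡k pot i 0<i = case atLevel i apexes ≟ 0 of λ
          { (yes e) → low e ; (no ¬e) → high (n≢0⇒n>0 ¬e) }
          where
          open ≤-Reasoning
          split-U′ : atLevel i U′ ≡ atLevel i Uʳ + atLevel i apexes
          split-U′ = length-filter-++ _ Uʳ apexes
          split-U : ∀ j → atLevel j Uᵏ + atLevel j Uʳ ≡ atLevel j U
          split-U j = length-partition (λ v → κ v ≟ⱽ k) (λ v → j ≤? level v) U
          low : atLevel i apexes ≡ 0 → i + 4 * atLevel i U′ ≤ M
          low e = ≤-trans (+-monoʳ-≤ i (*-monoʳ-≤ 4 U′≤U)) (pot i (≤-trans 0<i U′≤U))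
            where
            U′≤U : atLevel i U′ ≤ atLevel i U
            U′≤U = ≤-trans (≤-reflexive (trans split-U′ (trans (cong (atLevel i Uʳ +_) e) (+-identityʳ _))))
                           (≤-trans (m≤n+m _ _) (≤-reflexive (split-U i)))
          high : 0 < atLevel i apexes → i + 4 * atLevel i U′ ≤ M
          high 0<a
            with r , r∈ , i≤r ← 0<length⇒∃ (λ v → i ≤? level v) apexes 0<a
            with x , x∈ , min ← ∃-minimal level (∈-filter⁺ (λ v → κ v ≟ⱽ k) u∈U κu≡k) = begin
              i + 4 * atLevel i U′           ≤⟨ +-monoʳ-≤ i (*-monoʳ-≤ 4 U′≤) ⟩
              i + 4 * (n + a)                ≤⟨ +-monoˡ-≤ _ i≤l ⟩
              l + 2 * (D + y) + 4 * (n + a)  ≡⟨ eq₁ l D y n a ⟩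
              l + 4 * n + 2 * D + 2 * (y + 2 * a) ≤⟨ +-monoʳ-≤ (l + 4 * n + 2 * D) (*-monoʳ-≤ 2 heavy) ⟩
              l + 4 * n + 2 * D + 2 * D      ≡⟨ eq₂ l n D ⟩
              l + 4 * (D + n)                ≤⟨ +-monoʳ-≤ l (*-monoʳ-≤ 4 count) ⟩
              l + 4 * atLevel l U            ≤⟨ pot l (≤-trans 0<D (m+n≤o⇒m≤o D count)) ⟩
              M                              ∎
            where
            -- At most the lowest level of the class, so that the whole class counts, and at most
            -- `i`, so that the remaining vertices counted at `i` still do.
            l = i ⊓ level x
            D = length Uᵏ
            y = length (coloured Y)
            n = atLevel i Uʳ
            a = length apexes
            eq₁ : ∀ l D y n a → l + 2 * (D + y) + 4 * (n + a) ≡ l + 4 * n + 2 * D + 2 * (y + 2 * a)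
            eq₁ = solve-∀
            eq₂ : ∀ l n D → l + 4 * n + 2 * D + 2 * D ≡ l + 4 * (D + n)
            eq₂ = solve-∀
            U′≤ : atLevel i U′ ≤ n + a
            U′≤ = ≤-trans (≤-reflexive split-U′) (+-monoʳ-≤ n (List.length-filter _ apexes))
            0<D : 0 < D
            0<D = List.filter-some _ (lose u∈U κu≡k)
            i≤l : i ≤ l + 2 * (D + y)
            i≤l with ⊓-sel i (level x)
            ... | inj₁ e = ≤-trans (≤-reflexive (sym e)) (m≤m+n l _)
            ... | inj₂ e = ≤-trans i≤r (subst (λ m → level r ≤ m + 2 * (D + y)) (sym e)
                             (apex-level r∈ (proj₂ (∈-filter⁻ _ {xs = U} x∈))))
            count : D + n ≤ atLevel l U
            count = ≤-trans (+-mono-≤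
                (≤-reflexive (cong length (sym (List.filter-all (λ v → l ≤? level v) {Uᵏ}
                  (All.tabulate λ z∈ → ≤-trans (m⊓n≤n i _) (min z∈))))))
                (length-filter-mono _ _ (≤-trans (m⊓n≤m i _)) Uʳ))
              (≤-reflexive (split-U l))

  -- Each colour class of U that is large compared with the whites and apexes
  -- of that colour is replaced by these apexes; by the gap-freeness of the
  -- class they are not much higher than its lowest vertex.

  reduce : ∀ {M} Y cs → (∀ {c} → c ∈ cs → whites c ⊆ Y) → ∀ U → (∀ {c} → c ∈ cs → Holds U c) → Potential M U →
           ∃[ U′ ] ((∀ {c} → c ∈ cs → Holds U′ c) × Potential M U′ × length U′ ≤ length Y + 2 * length cs)
  reduce {M} Y cs W⊆Y U = go U (<-wellFounded (length U))
    where
    go : ∀ U → Acc _<_ (length U) → (∀ {c} → c ∈ cs → Holds U c) → Potential M U →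
         ∃[ U′ ] ((∀ {c} → c ∈ cs → Holds U′ c) × Potential M U′ × length U′ ≤ length Y + 2 * length cs)
    go U (acc rec) holds pot
      with ss , len , all ← supports U Y cs (λ c∈ → holds c∈ , W⊆Y c∈)
      with κ , linked , mono ← colouring U Y ss
      with any? (λ u → length (coloured U Y κ linked mono (κ u) Y) + 2 * length (apexes U Y κ linked mono (κ u))
                         ≤? length (coloured U Y κ linked mono (κ u) U)) U
    ... | yes heavy with u , u∈ , hv ← find heavy =
      go (U′ U Y κ linked mono (κ u)) (rec (replace-shorter U Y κ linked mono (κ u) hv u∈ refl))
         (λ c∈ → let s , s∈ , e = all c∈ in subst (Holds _) e (replace-holds U Y κ linked mono (κ u) s∈))
         (replace-potential U Y κ linked mono (κ u) hv u∈ refl pot)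
    ... | no ¬heavy = U , holds , pot , (begin
      length U                               ≡⟨ List.length-map κ U ⟨
      -- No class is heavy. Comparing lists of colours adds up these inequalities over all classes;
      -- `ks` is repeated to account for the coefficient 2.
      length (map κ U)                       ≤⟨ multiplicity-≤⇒length-≤ _≟ⱽ_ (map κ U) (map κ Y ++ ks ++ ks) light ⟩
      length (map κ Y ++ ks ++ ks)           ≡⟨ List.length-++ (map κ Y) ⟩
      length (map κ Y) + length (ks ++ ks)   ≡⟨ cong₂ _+_ (List.length-map κ Y) (List.length-++ ks) ⟩
      length Y + (length ks + length ks)     ≡⟨ cong (λ m → length Y + (m + m)) (trans (List.length-map _ ss) len) ⟩
      length Y + (length cs + length cs)     ≡⟨ cong (λ m → length Y + (length cs + m)) (+-identityʳ _) ⟨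
      length Y + 2 * length cs               ∎)
      where
      open ≤-Reasoning
      ks = map (κ ∘ Support.pick) ss
      #_ : V → List V → ℕ
      #_ = multiplicity _≟ⱽ_
      light : ∀ {k} → k ∈ map κ U → (# k) (map κ U) ≤ (# k) (map κ Y ++ ks ++ ks)
      light k∈ with u , u∈ , refl ← ∈-map⁻ κ k∈ = begin
        (# k) (map κ U)                               ≡⟨ multiplicity-map _≟ⱽ_ κ k U ⟩
        length (coloured U Y κ linked mono k U)       ≤⟨ ≰⇒≥ (λ le → ¬heavy (lose u∈ le)) ⟩
        length (coloured U Y κ linked mono k Y) + 2 * length (apexes U Y κ linked mono k)
          ≡⟨ cong₂ _+_ (sym (multiplicity-map _≟ⱽ_ κ k Y))
                       (cong (2 *_) (trans (List.length-map _ (filter _ ss))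
                                    (sym (multiplicity-map _≟ⱽ_ (κ ∘ Support.pick) k ss)))) ⟩
        (# k) (map κ Y) + ((# k) ks + ((# k) ks + 0))  ≡⟨ cong (λ m → (# k) (map κ Y) + ((# k) ks + m)) (+-identityʳ _) ⟩
        (# k) (map κ Y) + ((# k) ks + (# k) ks)        ≡⟨ cong ((# k) (map κ Y) +_) (length-filter-++ (_≟ⱽ k) ks ks) ⟨
        (# k) (map κ Y) + (# k) (ks ++ ks)             ≡⟨ length-filter-++ (_≟ⱽ k) (map κ Y) (ks ++ ks) ⟨
        (# k) (map κ Y ++ ks ++ ks)                    ∎
        where k = κ u

-- Lower bound: clause sets and hiding sets

infix 4 _⊨_

_⊨_ : ∀ {n} → (Fin n → Bool) → Clause n → Set
α ⊨ C = ∃[ x ] ∃[ b ] ((x , b) ∈ˡ C × α x ≡ b)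

⊨𝟘-absurd : ∀ {n} {α : Fin n → Bool} → ¬ (α ⊨ 𝟘)
⊨𝟘-absurd (x , b , l∈ , _) = case trans (sym (Vec.lookup-replicate x nothing)) l∈ of λ ()

⊨-∨ˡ : ∀ {n} {α : Fin n → Bool} (C : Clause n) x b → α ⊨ C ∨ˡ (x , b) → α x ≡ b ⊎ α ⊨ C
⊨-∨ˡ C x b (y , a , l∈ , αy) with y Fin.≟ x
... | yes refl = inj₁ (trans αy (sym (Maybe.just-injective (trans (sym (Vec.lookup∘update y C (just b))) l∈))))
... | no  y≢x  = inj₂ (y , a , trans (sym (Vec.lookup∘update′ y≢x C (just b))) l∈ , αy)

⊨-resolvent : ∀ {n} {α : Fin n → Bool} {C₁ C₂ D} → Resolvent C₁ C₂ D → α ⊨ C₁ → α ⊨ C₂ → α ⊨ D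
⊨-resolvent {α = α} {D = D} r sat₁ sat₂
  with ⊨-∨ˡ B x true (subst (α ⊨_) C₁≡ sat₁) | ⊨-∨ˡ C x false (subst (α ⊨_) C₂≡ sat₂)
  where open Resolvent r
... | inj₂ (y , b , l∈ , e) | _ = y , b , Equivalence.from (Resolvent.D≡B∨C r _) (inj₁ l∈) , e
... | inj₁ _ | inj₂ (y , b , l∈ , e) = y , b , Equivalence.from (Resolvent.D≡B∨C r _) (inj₂ l∈) , e
... | inj₁ t | inj₁ f = case trans (sym t) f of λ ()

another : ∀ {d} → 2 ≤ d → (k : Fin d) → ∃[ l ] k ≢ l
another (s≤s (s≤s _)) zero    = suc zero , λ ()
another (s≤s (s≤s _)) (suc k) = zero , λ ()

module Assignments (d : ℕ) (2≤d : 2 ≤ d) (G : PebblingDAG)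
  (_≟ⱽ_ : DecidableEquality (PebblingDAG.Vertex G))
  (hidden? : ∀ E v → Dec (Hiding.Hidden G E v)) where
  open PebblingDAG G
  open Variables d G
  open Hiding G
  open import Data.List.Membership.DecPropositional _≟ⱽ_ using () renaming (_∈?_ to _∈ⱽ?_)

  private
    n = numVars d G

  record Model (U : List Vertex) (T : Vertex → Bool) : Set where
    field
      closed     : ∀ {u v w} → preds w ≡ just (u , v) → T u ≡ true → T v ≡ true → T w ≡ true
      includes   : ∀ {u} → u ∈ U → T u ≡ true
      sink-false : T sink ≡ false

  hidden-true : ∀ {U E T v} → Model U T → (∀ {u} → u ∈ E → T u ≡ true) → Hidden E v → T v ≡ true
  hidden-true m E⊆T (blocked v∈) = E⊆T v∈
  hidden-true m E⊆T (join e p q) = Model.closed m e (hidden-true m E⊆T p) (hidden-true m E⊆T q)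

  -- The vertices hidden by `E` form the least set that contains `E` and is closed under
  -- propagation.
  closure-model : ∀ {U E} → U ⊆ E → ¬ Hidden E sink → Model U (λ v → does (hidden? E v))
  closure-model {E = E} U⊆E ¬sink = record
    { closed     = λ e p q → dec-true (hidden? E _) (join e (true⇒hidden p) (true⇒hidden q))
    ; includes   = λ u∈ → dec-true (hidden? E _) (blocked (U⊆E u∈))
    ; sink-false = dec-false (hidden? E sink) ¬sink
    }
    where
    true⇒hidden : ∀ {v} → does (hidden? E v) ≡ true → Hidden E v
    true⇒hidden {v} e with hidden? E v
    ... | yes p = p

  value : (Vertex → Bool) → (Vertex → Fin d) → Fin n → Bool
  value T ι x = T (owner x) ∧ does (bit x Fin.≟ ι (owner x))

  value-var : ∀ T ι v → T v ≡ true → value T ι (var d G v (ι v)) ≡ true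
  value-var T ι v e rewrite owner-var v (ι v) | e = dec-true (_ Fin.≟ _) (bit-var v (ι v))

  value-false : ∀ T ι x → T (owner x) ≡ false → value T ι x ≡ false
  value-false T ι x e rewrite e = refl

  value-other : ∀ T ι x → bit x ≢ ι (owner x) → value T ι x ≡ false
  value-other T ι x ≢ = trans (cong (T (owner x) ∧_) (dec-false (_ Fin.≟ _) ≢)) (Bool.∧-zeroʳ _)

  value-true : ∀ T ι x → T (owner x) ≡ true → bit x ≡ ι (owner x) → value T ι x ≡ true
  value-true T ι x t e rewrite t = dec-true (_ Fin.≟ _) e

  value-true⁻ : ∀ T ι x → value T ι x ≡ true → T (owner x) ≡ true × bit x ≡ ι (owner x)
  value-true⁻ T ι x e with T (owner x) | bit x Fin.≟ ι (owner x)
  ... | true | yes p = refl , p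

  Hides : List Vertex → (Vertex → Fin d) → Config n → Set
  Hides U ι ℂ = ∀ {T} → Model U T → ∀ {C} → C ∈ ℂ → value T ι ⊨ C

  some-true : ∀ T ι v {ls} → Consistent ls → some d G v ⊆ ls → T v ≡ true → value T ι ⊨ ⋁ ls
  some-true T ι v con sub e =
    _ , true , ∈⋁⁺ con (sub (∈-map⁺ _ (∈-allFin (ι v)))) , value-var T ι v e

  var-false : ∀ T ι v i → T v ≡ false → value T ι (var d G v i) ≡ false
  var-false T ι v i e = value-false T ι _ (trans (cong T (owner-var v i)) e)

  propagation-true : ∀ {U T u v w} → Model U T → ∀ ι → preds w ≡ just (u , v) → ∀ i j →
                     value T ι ⊨ ⋁ (neg (var d G u i) ∷ neg (var d G v j) ∷ some d G w)
  propagation-true {T = T} {u} {v} {w} m ι e i j with T u in eu | T v in ev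
  ... | true  | true  = some-true T ι w (propagation-consistent e i j) (there ∘ there) (Model.closed m e eu ev)
  ... | false | _     = _ , false , ∈⋁⁺ (propagation-consistent e i j) (here refl) , var-false T ι u i eu
  ... | true  | false = _ , false , ∈⋁⁺ (propagation-consistent e i j) (there (here refl)) , var-false T ι v j ev

  sink-true : ∀ {U T} → Model U T → ∀ ι i → value T ι ⊨ ⋁ [ neg (var d G sink i) ]
  sink-true {T = T} m ι i = _ , false , ∈⋁⁺ {ls = [ neg (var d G sink i) ]} (consistent-∷ (λ _ ()) (λ ())) (here refl) ,
                    var-false T ι sink i (Model.sink-false m)

  TrueGiven : List Vertex → Clause n → Set
  TrueGiven S C = ∀ {U T} → S ⊆ U → Model U T → ∀ ι → value T ι ⊨ C

  axiom-true : ∀ {C} → C ∈ Peb d G →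
               TrueGiven [] C ⊎ ∃[ s ] (preds s ≡ nothing × TrueGiven [ s ] C)
  axiom-true {C} C∈F with ∈-++⁻ (concatMap (vertexAxioms d G) vertices) C∈F
  ... | inj₂ C∈ with i , _ , refl ← ∈-map⁻ _ C∈ = inj₁ λ _ m ι → sink-true m ι i
  ... | inj₁ C∈ with w , _ , C∈w ← find (∈-concatMap⁻ (vertexAxioms d G) {xs = vertices} C∈)
        with vertexAxiom⁻ w C∈w
  ...   | inj₁ (e , refl) = inj₂ (w , e , λ {_} {T} S⊆U m ι →
            some-true T ι w (some-consistent w) id (Model.includes m (S⊆U (here refl))))
  ...   | inj₂ (u , v , i , j , e , refl) = inj₁ λ _ m ι → propagation-true m ι e i j

  -- From clauses to constraints

  negatives : Clause n → List Vertex
  negatives C = map owner (filter (λ x → Maybe.≡-dec Bool._≟_ (lookup C x) (just false)) (allFin n))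

  ∈-negatives⁻ : ∀ C {v} → v ∈ negatives C → ∃[ x ] (neg x ∈ˡ C × v ≡ owner x)
  ∈-negatives⁻ C v∈ with x , x∈ , e ← ∈-map⁻ owner v∈ =
    x , proj₂ (∈-filter⁻ _ {xs = allFin n} x∈) , e

  ∈-negatives⁺ : ∀ C {x} → neg x ∈ˡ C → owner x ∈ negatives C
  ∈-negatives⁺ C {x} x∈ = ∈-map⁺ owner (∈-filter⁺ _ (∈-allFin x) x∈)

  -- A negated variable that `ι` does not select is false for every `T`, so the clause is true
  -- regardless of `U`.
  Satisfied : (Vertex → Fin d) → List Vertex → Clause n → Set
  Satisfied ι Y C = ∃[ x ] (neg x ∈ˡ C × owner x ∈ Y × bit x ≢ ι (owner x))

  -- Ensures that `C` is true once `v` is: vacuously at the sink, which no model makes true, and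
  -- otherwise by a positive literal that `ι` selects. Membership in `Y` freezes this choice of `ι`.
  Supports : (Vertex → Fin d) → List Vertex → Clause n → Vertex → Set
  Supports ι Y C v = v ≡ sink ⊎ ∃[ x ] (pos x ∈ˡ C × owner x ≡ v × bit x ≡ ι v × v ∈ Y)

  Forced : List Vertex → (Vertex → Fin d) → List Vertex → Clause n → Set
  Forced U ι Y C = ∃[ v ] (Hidden (U ++ negatives C) v × Supports ι Y C v)

  -- The truth of C depends on ι only through its values on Y.

  Status : List Vertex → (Vertex → Fin d) → List Vertex → Clause n → Set
  Status U ι Y C = Satisfied ι Y C ⊎ Forced U ι Y C

  Extends : (Vertex → Fin d) → List Vertex → (Vertex → Fin d) → List Vertex → Set
  Extends ι Y ι′ Y′ = Y ⊆ Y′ × (∀ {v} → v ∈ Y → ι′ v ≡ ι v)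

  satisfied-extends : ∀ {ι Y ι′ Y′ C} → Extends ι Y ι′ Y′ → Satisfied ι Y C → Satisfied ι′ Y′ C
  satisfied-extends (Y⊆ , same) (x , x∈ , o∈ , ≢) = x , x∈ , Y⊆ o∈ , λ e → ≢ (trans e (same o∈))

  status-extends : ∀ {U ι Y ι′ Y′ C} → Extends ι Y ι′ Y′ → Status U ι Y C → Status U ι′ Y′ C
  status-extends {C = C} ext (inj₁ s) = inj₁ (satisfied-extends {C = C} ext s)
  status-extends ext (inj₂ (v , hid , inj₁ e)) = inj₂ (v , hid , inj₁ e)
  status-extends (Y⊆ , same) (inj₂ (v , hid , inj₂ (x , x∈ , o , e , v∈))) =
    inj₂ (v , hid , inj₂ (x , x∈ , o , trans e (sym (same v∈)) , Y⊆ v∈))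

  -- `C` is evaluated in the least model containing `U` and the vertices that `C` negates. A true
  -- positive literal belongs to a hidden vertex; a true negative one must be unselected by `ι`, its
  -- vertex being true. If there is no such model, the sink is hidden.
  clause-status : ∀ {U ι C} → (∀ {T} → Model U T → value T ι ⊨ C) → ∃[ Y ] (length Y ≤ 1 × Status U ι Y C)
  clause-status {U} {ι} {C} true-in with hidden? (U ++ negatives C) sink
  ... | yes hid = [] , z≤n , inj₂ (sink , hid , inj₁ refl)
  ... | no ¬hid with true-in m
    where m = closure-model {U} {U ++ negatives C} ∈-++⁺ˡ ¬hid
  ...   | x , true , x∈ , e = [ owner x ] , ≤-refl ,
            inj₂ (owner x , hid , inj₂ (x , x∈ , refl , proj₂ t , here refl))
    where
    t = value-true⁻ (λ v → does (hidden? (U ++ negatives C) v)) ι x e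
    hid : Hidden (U ++ negatives C) (owner x)
    hid with hidden? (U ++ negatives C) (owner x) | proj₁ t
    ... | yes p | _ = p
  ...   | x , false , x∈ , e = [ owner x ] , ≤-refl , inj₁ (x , x∈ , here refl , λ bit≡ →
            case trans (sym e) (value-true (λ v → does (hidden? (U ++ negatives C) v)) ι x
              (dec-true (hidden? _ _) (blocked (∈-++⁺ʳ U (∈-negatives⁺ C x∈)))) bit≡) of λ ())

  config-status : ∀ {U ι} ℂ → Hides U ι ℂ →
                  ∃[ Y ] (length Y ≤ length ℂ × (∀ {C} → C ∈ ℂ → Status U ι Y C))
  config-status [] _ = [] , z≤n , λ ()
  config-status {U} {ι} (C ∷ ℂ) hides
    with Y₁ , len₁ , st ← clause-status {U} {ι} {C} (λ m → hides m (here refl))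
    with Y₂ , len₂ , sts ← config-status {U} {ι} ℂ (λ m C∈ → hides m (there C∈)) =
    Y₁ ++ Y₂ , ≤-trans (≤-reflexive (List.length-++ Y₁)) (+-mono-≤ len₁ len₂) , λ
      { (here refl) → status-extends {C = C} (∈-++⁺ˡ , λ _ → refl) st
      ; {C′} (there C∈) → status-extends {C = C′} (∈-++⁺ʳ Y₁ , λ _ → refl) (sts C∈) }

  Settled : (Vertex → Fin d) → List Vertex → Clause n → Set
  Settled ι Y C = Satisfied ι Y C ⊎ negatives C ⊆ Y

  settled-extends : ∀ {ι Y ι′ Y′ C} → Extends ι Y ι′ Y′ → Settled ι Y C → Settled ι′ Y′ C
  settled-extends {C = C} ext = Sum.map (satisfied-extends {C = C} ext) (proj₁ ext ∘_)

  settle-clause : ∀ ι Y C → ∃[ ι′ ] ∃[ Y′ ] (length Y′ ≤ suc (length Y) × Extends ι Y ι′ Y′ × Settled ι′ Y′ C)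
  settle-clause ι Y C with any? (λ v → ¬? (v ∈ⱽ? Y)) (negatives C)
  ... | no  all = ι , Y , n≤1+n _ , (id , λ _ → refl) , inj₂ sub
    where
    sub : negatives C ⊆ Y
    sub {v} v∈ with v ∈ⱽ? Y
    ... | yes p = p
    ... | no ¬p = contradiction (lose v∈ ¬p) all
  ... | yes ex with v , v∈ , v∉Y ← find ex with x , x∈ , refl ← ∈-negatives⁻ C v∈ =
    ι′ , owner x ∷ Y , ≤-refl , (there , same) , inj₁ (x , x∈ , here refl , fresh)
    where
    flipped = another 2≤d (bit x)
    ι′ : Vertex → Fin d
    ι′ u with u ≟ⱽ owner x
    ... | yes _ = proj₁ flipped
    ... | no  _ = ι u
    same : ∀ {u} → u ∈ Y → ι′ u ≡ ι u
    same {u} u∈ with u ≟ⱽ owner x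
    ... | yes refl = contradiction u∈ v∉Y
    ... | no  _    = refl
    fresh : bit x ≢ ι′ (owner x)
    fresh with owner x ≟ⱽ owner x
    ... | yes _  = proj₂ flipped
    ... | no  ≢ = contradiction refl ≢

  -- A clause with a negative literal at a vertex not yet in Y is made true
  -- once and for all by changing ι there.

  settle : ∀ ι Y ℂ → ∃[ ι′ ] ∃[ Y′ ] (length Y′ ≤ length Y + length ℂ × Extends ι Y ι′ Y′ ×
           (∀ {C} → C ∈ ℂ → Settled ι′ Y′ C))
  settle ι Y [] = ι , Y , m≤m+n _ 0 , (id , λ _ → refl) , λ ()
  settle ι Y (C ∷ ℂ)
    with ι₁ , Y₁ , len₁ , (sub₁ , same₁) , st ← settle-clause ι Y C
    with ι₂ , Y₂ , len₂ , ext@(sub₂ , same₂) , sts ← settle ι₁ Y₁ ℂ =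
    ι₂ , Y₂ , ≤-trans len₂ (≤-trans (+-monoˡ-≤ (length ℂ) len₁) (≤-reflexive (sym (+-suc (length Y) (length ℂ))))) ,
    (sub₂ ∘ sub₁ , λ v∈ → trans (same₂ (sub₁ v∈)) (same₁ v∈)) ,
    λ { (here refl) → settled-extends {C = C} ext st ; (there C∈) → sts C∈ }

  Represents : (Vertex → Fin d) → List Vertex → Clause n → Constraint → Set
  Represents ι Y C c = whites c ≡ negatives C × Supports ι Y C (apex c)

  constraints : ∀ {U ι Y} ℂ → (∀ {C} → C ∈ ℂ → Status U ι Y C × Settled ι Y C) →
    ∃[ cs ] (length cs ≤ length ℂ × (∀ {c} → c ∈ cs → whites c ⊆ Y × Holds U c) ×
             (∀ {C} → C ∈ ℂ → Satisfied ι Y C ⊎ ∃[ c ] (c ∈ cs × Represents ι Y C c)))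
  constraints [] _ = [] , z≤n , (λ ()) , λ ()
  constraints {U} {ι} {Y} (C ∷ ℂ) hyp
    with cs , len , ok , rep ← constraints {U} {ι} {Y} ℂ (hyp ∘ there) | hyp (here refl)
  ... | inj₁ s , _ = cs , m≤n⇒m≤1+n len , ok , λ { (here refl) → inj₁ s ; (there C∈) → rep C∈ }
  ... | _ , inj₁ s = cs , m≤n⇒m≤1+n len , ok , λ { (here refl) → inj₁ s ; (there C∈) → rep C∈ }
  ... | inj₂ (v , hid , sup) , inj₂ N⊆Y =
    (v ⟨ negatives C ⟩) ∷ cs , s≤s len , (λ { (here refl) → N⊆Y , hid ; (there c∈) → ok c∈ }) , λ
      { (here refl) → inj₂ (_ , here refl , refl , sup)
      ; (there C∈) → Sum.map₂ (λ (c , c∈ , r) → c , there c∈ , r) (rep C∈) }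

  satisfied-true : ∀ T {ι Y C} → Satisfied ι Y C → value T ι ⊨ C
  satisfied-true T {ι} (x , x∈ , _ , ≢) = x , false , x∈ , value-other T ι x ≢

  -- A false vertex among those negated yields a true negative literal. If there is none,
  -- propagation makes the apex true, and the apex supports `C`.
  represented-true : ∀ {U T ι Y C c} → Model U T → Represents ι Y C c → Holds U c → value T ι ⊨ C
  represented-true {U} {T} {ι} {Y} {C} {c} m (refl , sup) hid
    with any? (λ v → T v Bool.≟ false) (negatives C)
  ... | yes ex with v , v∈ , Tv ← find ex with x , x∈ , refl ← ∈-negatives⁻ C v∈ =
    x , false , x∈ , value-false T ι x Tv
  ... | no ¬ex = support sup (hidden-true m all-true hid)
    where
    all-true : ∀ {v} → v ∈ U ++ negatives C → T v ≡ true
    all-true {v} v∈ with ∈-++⁻ U v∈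
    ... | inj₁ v∈U = Model.includes m v∈U
    ... | inj₂ v∈N with T v in eq
    ...   | true  = refl
    ...   | false = contradiction (lose v∈N eq) ¬ex
    support : ∀ {v} → Supports ι Y C v → T v ≡ true → value T ι ⊨ C
    support (inj₁ refl) T-sink = case trans (sym T-sink) (Model.sink-false m) of λ ()
    support (inj₂ (x , x∈ , refl , e , _)) Tv = x , true , x∈ , value-true T ι x Tv e

  -- Each clause puts at most one vertex into `Y` for its status and one more to settle it, hence
  -- twice the space. The statuses survive the change to `ι′`, which agrees with `ι` on the earlier
  -- `Y`.
  extract : ∀ {U ι ℂ} → Hides U ι ℂ →
    ∃[ ι′ ] ∃[ Y ] ∃[ cs ] (length Y ≤ length ℂ + length ℂ × length cs ≤ length ℂ ×
      (∀ {c} → c ∈ cs → whites c ⊆ Y × Holds U c) ×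
      (∀ {U′} → (∀ {c} → c ∈ cs → Holds U′ c) → Hides U′ ι′ ℂ))
  extract {U} {ι} {ℂ} hides
    with Y , lenY , sts ← config-status {U} {ι} ℂ hides
    with ι′ , Y′ , lenY′ , ext , settled ← settle ι Y ℂ
    with cs , len-cs , ok , rep ← constraints {U} {ι′} {Y′} ℂ (λ {C} C∈ → status-extends {C = C} ext (sts C∈) , settled C∈) =
    ι′ , Y′ , cs , ≤-trans lenY′ (+-monoˡ-≤ (length ℂ) lenY) , len-cs , ok , hides′
    where
    hides′ : ∀ {U′} → (∀ {c} → c ∈ cs → Holds U′ c) → Hides U′ ι′ ℂ
    hides′ holds {T} m {C} C∈ with rep C∈
    ... | inj₁ s             = satisfied-true T {ι′} {C = C} s
    ... | inj₂ (c , c∈ , r) = represented-true {C = C} m r (holds c∈)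

  model-⊆ : ∀ {U U′ T} → U ⊆ U′ → Model U′ T → Model U T
  model-⊆ sub m = record { closed = Model.closed m ; includes = Model.includes m ∘ sub ; sink-false = Model.sink-false m }

  -- `Small` and `reduction` abstract the bound on Klawe's measure and the lemma `reduce`, so that
  -- the argument along a refutation does not refer to pyramids.
  module _ (s : ℕ) (Small : List Vertex → Set) (small-[] : Small [])
    (small-∷ : ∀ {v U} → preds v ≡ nothing → length U ≤ 4 * s → Small U → Small (v ∷ U))
    (reduction : ∀ Y cs → (∀ {c} → c ∈ cs → whites c ⊆ Y) → ∀ U → (∀ {c} → c ∈ cs → Holds U c) → Small U →
       ∃[ U′ ] ((∀ {c} → c ∈ cs → Holds U′ c) × Small U′ × length U′ ≤ length Y + 2 * length cs))
    where

    private F = Peb d G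

    Invariant : Config n → Set
    Invariant ℂ = ∃[ U ] ∃[ ι ] (Hides U ι ℂ × Small U)

    compress : ∀ {ℂ} → Invariant ℂ → ∃[ U ] ∃[ ι ] (Hides U ι ℂ × Small U × length U ≤ 4 * length ℂ)
    compress {ℂ} (U , ι , hides , small)
      with ι′ , Y , cs , lenY , len-cs , ok , back ← extract {U} {ι} {ℂ} hides
      with U′ , holds , small′ , lenU′ ← reduction Y cs (λ c∈ → proj₁ (ok c∈)) U (λ c∈ → proj₂ (ok c∈)) small =
      U′ , ι′ , back holds , small′ , (begin
        length U′                           ≤⟨ lenU′ ⟩
        length Y + 2 * length cs            ≤⟨ +-mono-≤ lenY (*-monoʳ-≤ 2 len-cs) ⟩
        length ℂ + length ℂ + 2 * length ℂ  ≡⟨ eq (length ℂ) ⟩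
        4 * length ℂ                        ∎)
      where
      open ≤-Reasoning
      eq : ∀ m → m + m + 2 * m ≡ 4 * m
      eq = solve-∀

    step-invariant : ∀ {ℂ ℂ′} → length ℂ ≤ s → Step F ℂ ℂ′ → Invariant ℂ → Invariant ℂ′
    step-invariant {ℂ} _ (erase {C} _) (U , ι , hides , small) =
      U , ι , (λ m D∈ → hides m (proj₁ (∈-filter⁻ (λ D → ¬? (D ≟ᶜ C)) {xs = ℂ} D∈))) , small
    step-invariant {ℂ} _ (infer {D = D} C₁∈ C₂∈ r) (U , ι , hides , small) =
      U , ι , (λ m D∈ → case ∈-insert⁻ D ℂ D∈ of λ
        { (inj₁ refl) → ⊨-resolvent r (hides m C₁∈) (hides m C₂∈) ; (inj₂ D∈ℂ) → hides m D∈ℂ }) , small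
    step-invariant {ℂ} ℂ≤s (download {C} C∈F) inv
      with U , ι , hides , small , U≤ ← compress inv | axiom-true C∈F
    ... | inj₁ C-true = U , ι , (λ m D∈ → case ∈-insert⁻ C ℂ D∈ of λ
        { (inj₁ refl) → C-true (λ ()) m ι ; (inj₂ D∈ℂ) → hides m D∈ℂ }) , small
    ... | inj₂ (v , e , C-true) = v ∷ U , ι , (λ m D∈ → case ∈-insert⁻ C ℂ D∈ of λ
        { (inj₁ refl) → C-true (λ { (here refl) → here refl }) m ι
        ; (inj₂ D∈ℂ) → hides (model-⊆ there m) D∈ℂ }) , small-∷ e (≤-trans U≤ (*-monoʳ-≤ 4 ℂ≤s)) small

    derivation-hides : ∀ {ℂ} (π : Star (Step F) ℂ [ 𝟘 ]) → clauseSpace π ≤ s → Invariant ℂ →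
                       ∃[ U ] (Small U × Hidden U sink)
    derivation-hides ε _ (U , ι , hides , small) with hidden? U sink
    ... | yes hid = U , small , hid
    -- Otherwise the vertices hidden by `U` would be a model, and its assignment would satisfy the
    -- empty clause.
    ... | no ¬hid = contradiction (hides (closure-model id ¬hid) (here refl)) ⊨𝟘-absurd
    derivation-hides (_◅_ {ℂ} st π) le inv =
      derivation-hides π (m⊔n≤o⇒n≤o (length ℂ) (clauseSpace π) le)
        (step-invariant (m⊔n≤o⇒m≤o (length ℂ) (clauseSpace π) le) st inv)

    refutation-hides : (π : Refutation F) → clauseSpace π ≤ s → ∃[ U ] (Small U × Hidden U sink)
    refutation-hides π le = derivation-hides π le ([] , (λ _ → fromℕ< (<⇒≤ 2≤d)) , (λ _ ()) , small-[])

-- Linear bounds for the pyramid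

pyramid-space-lower : ∀ d h → 2 ≤ d → (π : Refutation (Peb d (pyramid h))) → h ≤ 4 * (1 + 4 * clauseSpace π)
pyramid-space-lower d h 2≤d π =
  let U , pot , hid = Assignments.refutation-hides d 2≤d (pyramid h) _≟ⱽ_ hidden? s (Potential M) (λ _ ())
                        small-∷ reduce π ≤-refl
  in hidden-sink⇒tall pot hid
  where
  open Geometry h
  open Reduction h
  s = clauseSpace π
  -- The measure at level 0 of a compressed set with one more source. At higher levels the source
  -- does not count, so the old bound persists there.
  M = 4 * (1 + 4 * s)
  small-∷ : ∀ {v U} → Pyramid.preds h v ≡ nothing → length U ≤ 4 * s → Potential M U → Potential M (v ∷ U)
  small-∷ {v} {U} _ U≤ _ zero _ = *-monoʳ-≤ 4 (≤-trans (List.length-filter (λ v → 0 ≤? level v) (v ∷ U)) (s≤s U≤))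
  small-∷ {vertex zero i b} _ _ pot (suc j) 0< = pot (suc j) 0<

1≤clauseSpace : ∀ {n} {F : Formula n} {ℂ} (π : Star (Step F) ℂ [ 𝟘 ]) → 1 ≤ clauseSpace π
1≤clauseSpace ε       = ≤-refl
1≤clauseSpace (_ ◅ π) = ≤-trans (1≤clauseSpace π) (m≤n⊔m _ _)

space-linear : ∀ {N : ℕ → ℕ} (F : ∀ h → Formula (N h)) c → (∀ h → RefutableIn (F h) (h + c)) →
  (∀ h (π : Refutation (F h)) → h ≤ 4 * (1 + 4 * clauseSpace π)) →
  ∃[ sp ] ((∀ h → 1 ≤ h → Sp[ F h ⊢𝟘]≡ sp h) × sp ∈Θ (λ h → h))
space-linear F c refutable tall =
  -- The constant 20 is `4 * 5`, the summand 1 in `tall` being absorbed by a space of at least 1.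
  -- Starting at `h = 1` lets `suc c` absorb the summand `c`.
  sp , (λ h _ → is-space h) , 20 , suc c , 1 , s≤s z≤n , s≤s z≤n , λ h 1≤h → lower h , upper h 1≤h
  where
  open ≤-Reasoning
  minimum : ∀ h → ∃[ s ] (Sp[ F h ⊢𝟘]≡ s × s ≤ h + c)
  minimum h = space-exists (F h) (h + c) (refutable h)
  sp : ℕ → ℕ
  sp h = proj₁ (minimum h)
  is-space : ∀ h → Sp[ F h ⊢𝟘]≡ sp h
  is-space h = proj₁ (proj₂ (minimum h))
  lower : ∀ h → h ≤ 20 * sp h
  lower h = let (π , eq) , _ = is-space h in subst (λ s → h ≤ 20 * s) eq (begin
    h                            ≤⟨ tall h π ⟩
    4 * (1 + 4 * clauseSpace π)  ≤⟨ *-monoʳ-≤ 4 (+-monoˡ-≤ (4 * clauseSpace π) (1≤clauseSpace π)) ⟩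
    4 * (5 * clauseSpace π)      ≡⟨ *-assoc 4 5 (clauseSpace π) ⟨
    20 * clauseSpace π           ∎)
  upper : ∀ h → 1 ≤ h → sp h ≤ suc c * h
  upper h 1≤h = begin
    sp h       ≤⟨ proj₂ (proj₂ (minimum h)) ⟩
    h + c      ≡⟨ cong (h +_) (*-identityʳ c) ⟨
    h + c * 1  ≤⟨ +-monoʳ-≤ h (*-monoʳ-≤ c 1≤h) ⟩
    h + c * h  ∎

theorem1p1 : ∀ (d : ℕ) → 2 ≤ d →
    ∃[ sp ] ((∀ h → 1 ≤ h → Sp[ Peb d (pyramid h) ⊢𝟘]≡ sp h) × sp ∈Θ (λ h → h))
theorem1p1 d 2≤d = space-linear (λ h → Peb d (pyramid h)) (3 + (d + d))
  (λ h → Upper.refutable d h (<⇒≤ 2≤d)) (λ h → pyramid-space-lower d h 2≤d)
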